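{- Let $G$ be a connected planar graph. Then there are a graph $G_1$ with $CCW(G_1)\le 7$ and a chordal graph $G_2$ such that $G=G_1\cap G_2$.
   Context: Graphs are finite, simple and undirected. $G=G_1\cap G_2$ means that $V(G_1)=V(G_2)=V(G)$ and $E(G)=E(G_1)\cap E(G_2)$. A clique cover of a graph $G$ is a partition of $V(G)$ into cliques. For an ordered clique cover $C=\{C_0,C_1,\dots,C_t\}$, its width is $W(C)=\max\{|j-i| : xy\in E(G),\ x\in C_i,\ y\in C_j\}$ (taken as $0$ if there are no edges). The clique cover width $CCW(G)$ is the smallest width over all ordered clique covers of $G$. A graph is chordal if it has no induced (chordless) cycle of length at least four. -}

module Defs where

open import Data.Bool.Base using (Bool; true; false; _∧_; T)
open import Data.Bool.Properties using (T?)
open import Data.Fin.Base using (Fin; toℕ)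
open import Data.List.Base using (List; map; filter; allFin; cartesianProduct)
open import Data.List.Extrema.Nat using (max)
open import Data.Nat.Base using (ℕ; suc; _+_; _*_; _≤_; ∣_-_∣)
open import Data.Product.Base using (Σ-syntax; _×_; _,_; uncurry)
open import Data.Sum.Base using (_⊎_)
open import Function.Bundles using (_⇔_)
open import Function.Definitions using (Injective; Surjective)
open import Level using (0ℓ)
open import Relation.Binary.Construct.Closure.ReflexiveTransitive using (Star)
open import Relation.Binary.Core using (Rel)
open import Relation.Binary.PropositionalEquality using (_≡_; _≢_; subst)
open import Relation.Nullary.Negation using (¬_)

record Graph (n : ℕ) : Set where
  field
    adj    : Fin n → Fin n → Bool
    symm   : ∀ x y → adj x y ≡ adj y x
    irrefl : ∀ x → adj x x ≡ false

  _~_ : Rel (Fin n) 0ℓ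
  x ~ y = T (adj x y)

  Connects : Rel (Fin n) 0ℓ
  Connects = Star _~_

  edges : List (Fin n × Fin n)
  edges = filter (λ xy → T? (uncurry adj xy)) (cartesianProduct (allFin n) (allFin n))

module _ {n : ℕ} where

  Connected : Graph n → Set
  Connected G = ∀ x y → Graph.Connects G x y

  -- The vertex sets agree because all three graphs live on Fin n.
  IsIntersection : Graph n → Graph n → Graph n → Set
  IsIntersection G G₁ G₂ = ∀ x y → Graph.adj G x y ≡ Graph.adj G₁ x y ∧ Graph.adj G₂ x y

  -- Surjectivity says that the classes of the partition are nonempty.
  record OrderedCliqueCover (G : Graph n) : Set where
    open Graph G
    field
      size       : ℕ
      part       : Fin n → Fin size
      surjective : Surjective _≡_ _≡_ part
      clique     : ∀ x y → part x ≡ part y → x ≢ y → x ~ y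

    width : ℕ
    width = max 0 (map (λ (x , y) → ∣ toℕ (part y) - toℕ (part x) ∣) edges)

  -- CCW(G) = w
  record IsCCW (G : Graph n) (w : ℕ) : Set where
    open OrderedCliqueCover
    field
      attained : Σ[ C ∈ OrderedCliqueCover G ] width C ≡ w
      smallest : ∀ (C : OrderedCliqueCover G) → w ≤ width C

Next : ∀ {k} → Rel (Fin k) 0ℓ
Next {k} i j = (toℕ j ≡ suc (toℕ i)) ⊎ (suc (toℕ i) ≡ k × toℕ j ≡ 0)

module _ {n : ℕ} where

  record InducedCycle (G : Graph n) (k : ℕ) : Set where
    open Graph G
    field
      vertex    : Fin k → Fin n
      injective : Injective _≡_ _≡_ vertex
      cycle     : ∀ i j → Next i j → vertex i ~ vertex j
      chordless : ∀ i j → vertex i ~ vertex j → Next i j ⊎ Next j i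

  Chordal : Graph n → Set
  Chordal G = ∀ k → 4 ≤ k → ¬ InducedCycle G k

-- For an equivalence relation R: there are exactly k classes.
record HasClasses {A : Set} (R : Rel A 0ℓ) (k : ℕ) : Set where
  field
    class      : A → Fin k
    surjective : Surjective _≡_ _≡_ class
    classifies : ∀ x y → R x y ⇔ class x ≡ class y

Orbit : {A : Set} → (A → A) → Rel A 0ℓ
Orbit f = Star (λ x y → f x ≡ y)

module _ {n : ℕ} (G : Graph n) where
  open Graph G

  -- An edge together with one of its two orientations.
  record Dart : Set where
    constructor dart
    field
      source target : Fin n
      edge          : source ~ target

  open Dart

  reverse : Dart → Dart
  reverse (dart x y xy) = dart y x (subst T (symm x y) xy)

  -- A cyclic order of the darts leaving each vertex. Since `next` is
  -- transitive on each of these finite sets, it is a cyclic permutation there.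
  record RotationSystem : Set where
    field
      next        : Dart → Dart
      next-source : ∀ d → source (next d) ≡ source d
      next-cyclic : ∀ d e → source d ≡ source e → Orbit next d e

    faceStep : Dart → Dart
    faceStep d = next (reverse d)

  SameVertex SameEdge SameComponent : Rel Dart 0ℓ
  SameVertex    d e = source d ≡ source e
  SameEdge      d e = d ≡ e ⊎ reverse d ≡ e
  SameComponent d e = Connects (source d) (source e)

  -- Embeddings in the plane (equivalently the sphere) are represented, up to
  -- homeomorphism on each component, by rotation systems of genus 0: the
  -- faces are the orbits of faceStep, and Euler's formula V - E + F = 2 holds
  -- on each component. As V - E + F ≤ 2 holds on every component for any
  -- rotation system, it suffices to ask for equality of the sums. Isolated
  -- vertices carry no darts and are counted on neither side.
  record Planar : Set where
    field
      rotation    : RotationSystem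
      V E F C     : ℕ
      vertices    : HasClasses SameVertex V
      edgeClasses : HasClasses SameEdge E
      faces       : HasClasses (Orbit (RotationSystem.faceStep rotation)) F
      components  : HasClasses SameComponent C
      euler       : V + F ≡ E + 2 * C

{-# OPTIONS --safe #-}

-- Take a breadth-first spanning tree T of G, and let the layer of a vertex be its depth. Thicken T:
-- the walk around its boundary visits the vertices in a cyclic order, and Euler's formula forces the
-- edges outside T to be noncrossing chords of this cycle: adding the edges one at a time, starting
-- from the empty subgraph, changes the number of boundary walks by one each time, it has to fall from
-- V to 1 along T, and it can reach F at the end only if every other edge splits a walk in two.
-- Triangulate the polygon traced out by the walk, keeping the chords. Let G₂ join two vertices whenever
-- both are ancestors of corners of one triangle. Removing ears shows that G₂ is chordal, and as an
-- ear adds at most one vertex per layer, next to at most two old ones, G₂ has a 3-colouring that is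
-- proper within layers. Let G₁ arise from G by making each colour class of each layer a clique. These
-- cliques, ordered by layer and then by colour, give width at most 5, since edges of G join vertices
-- of the same or of consecutive layers.

module Submission where

open import Defs
open import Data.Bool.Base using (Bool; true; false; if_then_else_; _∧_; T)
open import Data.Bool.Properties as Boolₚ using (T?; T-∧; T-irrelevant; ¬-not)
open import Data.Empty using (⊥-elim)
open import Data.Fin.Base as Fin
  using (Fin; zero; suc; toℕ; fromℕ<; punchIn; punchOut; combine; finToFun; funToFin)
open import Data.Fin.Properties as Finₚ
  using ( pigeonhole; punchIn-punchOut; injective⇒≤; any?; all?; toℕ-fromℕ<; toℕ<n; toℕ-injective
        ; combine-injective; finToFun-funToFin )
open import Data.Fin.Subset as Subset using (Subset; inside; outside; ∣_∣)
open import Data.Fin.Subset.Properties using (∣p∣≤n; ∣⊥∣≡0)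
open import Data.List.Base using (cartesianProduct; allFin)
open import Data.List.Extrema.Nat using (max≤v⁺; xs≤max)
open import Data.List.Membership.Propositional.Properties
  using (∈-map⁺; ∈-filter⁺; ∈-cartesianProduct⁺; ∈-allFin)
import Data.List.Relation.Unary.All as All
import Data.List.Relation.Unary.All.Properties as Allₚ
open import Data.Nat.Base
  using (ℕ; zero; suc; _+_; _*_; _∸_; _≤_; _<_; z≤n; s≤s; s≤s⁻¹; ∣_-_∣)
open import Data.Nat.Divisibility using (_∣_; divides; ∣⇒≤; ∣m+n∣m⇒∣n)
open import Data.Nat.GeneralisedArithmetic using (fold; fold-+)
open import Data.Nat.Properties
open import Data.Nat.Solver using (module +-*-Solver)
open import Data.Product.Base using (Σ; Σ-syntax; ∃-syntax; _×_; _,_; proj₁; proj₂; uncurry)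
open import Data.Sum.Base using (_⊎_; inj₁; inj₂; [_,_]′)
open import Data.Vec.Base using (_∷_; lookup; _[_]≔_)
open import Data.Vec.Properties using (lookup∘update; lookup∘update′; lookup-replicate)
open import Function.Base using (_∘_; id)
open import Function.Bundles using (module Equivalence)
open import Function.Definitions using (Injective)
open import Relation.Binary.Construct.Closure.ReflexiveTransitive using (ε; _◅_; _◅◅_)
open import Relation.Binary.Definitions using (DecidableEquality; tri<; tri≈; tri>)
open import Relation.Binary.PropositionalEquality
open import Relation.Nullary using (¬_; Dec; yes; no; contradiction)
open import Relation.Nullary.Decidable
  using (isYes; toWitness; fromWitness; map′; ¬?; _×-dec_; _⊎-dec_; _→-dec_)
open import Relation.Unary using (Decidable)

-- Orbits under composition with a transposition

least : ∀ {P : ℕ → Set} → Decidable P → ∀ k → P k →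
        Σ[ m ∈ ℕ ] P m × m ≤ k × (∀ {j} → j < m → ¬ P j)
least P? zero p = zero , p , z≤n , λ ()
least {P} P? (suc k) p with P? zero
... | yes p₀ = zero , p₀ , z≤n , λ ()
... | no ¬p₀ with least (P? ∘ suc) k p
...   | m , pm , m≤k , min = suc m , pm , s≤s m≤k , below
  where
  below : ∀ {j} → j < suc m → ¬ P j
  below {zero}  _   = ¬p₀
  below {suc j} j<m = min (s≤s⁻¹ j<m)

module _ {D : Set} where

  fold-shift : ∀ (f : D → D) x k → fold (f x) f k ≡ f (fold x f k)
  fold-shift f x zero    = refl
  fold-shift f x (suc k) = cong f (fold-shift f x k)

  fold-injective : ∀ {f : D → D} → Injective _≡_ _≡_ f →
                   ∀ k {x y} → fold x f k ≡ fold y f k → x ≡ y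
  fold-injective inj zero    eq = eq
  fold-injective inj (suc k) eq = fold-injective inj k (inj eq)

  fold-cancel : ∀ {f : D → D} → Injective _≡_ _≡_ f →
                ∀ x {i j} → i ≤ j → fold x f i ≡ fold x f j → x ≡ fold x f (j ∸ i)
  fold-cancel {f} inj x {i} {j} i≤j eq = fold-injective inj i
    (trans eq (trans (cong (fold x f) (sym (m+[n∸m]≡n i≤j))) (fold-+ x f i)))

  fold-orbit : ∀ (f : D → D) x k → Orbit f x (fold x f k)
  fold-orbit f x zero    = ε
  fold-orbit f x (suc k) = fold-orbit f x k ◅◅ (refl ◅ ε)

  orbit-fold : ∀ {f : D → D} {x y} → Orbit f x y → ∃[ k ] fold x f k ≡ y
  orbit-fold ε = 0 , refl
  orbit-fold {f} {x} (refl ◅ o) with orbit-fold o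
  ... | k , eq = suc k , trans (sym (fold-shift f x k)) eq

  fold-periodic : ∀ (f : D → D) p {x} → fold x f p ≡ x → ∀ k → fold x f (k * p) ≡ x
  fold-periodic f p per zero = refl
  fold-periodic f p {x} per (suc k) =
    trans (fold-+ x f p) (trans (cong (λ z → fold z f p) (fold-periodic f p per k)) per)

  orbit-linear : ∀ {f : D → D} {x y z} → Orbit f x y → Orbit f x z → Orbit f y z ⊎ Orbit f z y
  orbit-linear ε q = inj₁ q
  orbit-linear p ε = inj₂ p
  orbit-linear (refl ◅ p) (refl ◅ q) = orbit-linear p q

  orbit-resp : ∀ {f g : D → D} → (∀ x → f x ≡ g x) → ∀ {x y} → Orbit f x y → Orbit g x y
  orbit-resp f≗g ε = ε
  orbit-resp f≗g (eq ◅ p) = trans (sym (f≗g _)) eq ◅ orbit-resp f≗g p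

  -- Representatives may share an orbit, so `k` only bounds the number of orbits from above. That is
  -- enough: the contradiction with Euler's formula comes from too few faces.
  Cover : (D → D) → ℕ → Set
  Cover f k = Σ[ r ∈ (Fin k → D) ] ∀ x → ∃[ i ] Orbit f (r i) x

  cover-resp : ∀ {f g : D → D} → (∀ x → f x ≡ g x) → ∀ {k} → Cover f k → Cover g k
  cover-resp f≗g (r , c) = r , λ x → proj₁ (c x) , orbit-resp f≗g (proj₂ (c x))

  classes≤cover : ∀ {f : D → D} {m k} → HasClasses (Orbit f) m → Cover f k → m ≤ k
  classes≤cover {f} {m} {k} H (r , c) = injective⇒≤ {f = λ i → proj₁ (c (rep i))} inj
    where
    open HasClasses H
    rep : Fin m → D
    rep i = proj₁ (surjective i)
    rep-class : ∀ i → class (r (proj₁ (c (rep i)))) ≡ i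
    rep-class i = trans (Equivalence.to (classifies _ _) (proj₂ (c (rep i)))) (proj₂ (surjective i) refl)
    inj : Injective _≡_ _≡_ (λ i → proj₁ (c (rep i)))
    inj {i} {j} eq = trans (sym (rep-class i)) (trans (cong (class ∘ r) eq) (rep-class j))

  -- x and y both return to themselves after a common multiple of their periods.
  recurrent⇒injective : ∀ {f : D → D} → (∀ x → Orbit f (f x) x) → Injective _≡_ _≡_ f
  recurrent⇒injective {f} rec {x} {y} fx≡fy with orbit-fold (rec x) | orbit-fold (rec y)
  ... | p , px | q , qy = begin
    x                                 ≡⟨ sym (fold-periodic f (suc p) px′ (suc q)) ⟩
    fold x f (suc q * suc p)          ≡⟨ sym (fold-shift f x (p + q * suc p)) ⟩
    fold (f x) f (p + q * suc p)      ≡⟨ cong (λ z → fold z f (p + q * suc p)) fx≡fy ⟩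
    fold (f y) f (p + q * suc p)      ≡⟨ fold-shift f y (p + q * suc p) ⟩
    fold y f (suc q * suc p)          ≡⟨ cong (fold y f) (*-comm (suc q) (suc p)) ⟩
    fold y f (suc p * suc q)          ≡⟨ fold-periodic f (suc q) qy′ (suc p) ⟩
    y                                 ∎
    where
    open ≡-Reasoning
    px′ : fold x f (suc p) ≡ x
    px′ = trans (sym (fold-shift f x p)) px
    qy′ : fold y f (suc q) ≡ y
    qy′ = trans (sym (fold-shift f y q)) qy

  -- By pigeonhole on the codes two iterates of `x` agree; injectivity cancels the common part and
  -- leaves a positive period.
  injective⇒recurrent : ∀ {m} (code : D → Fin m) → Injective _≡_ _≡_ code →
                        ∀ {f : D → D} → Injective _≡_ _≡_ f → ∀ x → Orbit f (f x) x
  injective⇒recurrent {m} code code-inj {f} inj x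
    with pigeonhole (n<1+n m) (λ i → code (fold x f (toℕ i)))
  ... | i , j , i<j , eq with toℕ j ∸ toℕ i in d | fold-cancel inj x (<⇒≤ i<j) (code-inj eq)
  ...   | zero  | _   = contradiction (m∸n≡0⇒m≤n d) (<⇒≱ i<j)
  ...   | suc k | per = subst (Orbit f (f x)) (trans (fold-shift f x k) (sym per)) (fold-orbit f (f x) k)

  orbit-sym : ∀ {f : D → D} → (∀ x → Orbit f (f x) x) → ∀ {x y} → Orbit f x y → Orbit f y x
  orbit-sym rec ε = ε
  orbit-sym rec (refl ◅ p) = orbit-sym rec p ◅◅ rec _

  -- `g` is `f` preceded by the transposition of `a` and `b`.
  record Exchange (f g : D → D) (a b : D) : Set where
    field
      at-a : g a ≡ f b
      at-b : g b ≡ f a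
      off  : ∀ x → x ≢ a → x ≢ b → g x ≡ f x

  module Exchanged (_≟_ : DecidableEquality D) {f g : D → D} {a b : D} (X : Exchange f g a b) where
    open Exchange X

    -- Cut the `f`-path at its last departure from `a` or `b`; from there on `f` and `g` agree.
    transfer : ∀ {x y} → Orbit f x y → Orbit g x y ⊎ Orbit g (f a) y ⊎ Orbit g (f b) y
    transfer ε = inj₁ ε
    transfer {x} (refl ◅ p) with transfer p
    ... | inj₂ q = inj₂ q
    ... | inj₁ q with x ≟ a | x ≟ b
    ...   | yes refl | _        = inj₂ (inj₁ q)
    ...   | no _     | yes refl = inj₂ (inj₂ q)
    ...   | no x≢a   | no x≢b   = inj₁ (off x x≢a x≢b ◅ q)

    first-hit : ∀ {x} → Orbit f x a → Orbit g x a ⊎ Orbit g x b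
    first-hit ε = inj₁ ε
    first-hit {x} (refl ◅ p) with x ≟ a | x ≟ b
    ... | yes refl | _        = inj₁ ε
    ... | no _     | yes refl = inj₂ ε
    ... | no x≢a   | no x≢b   with first-hit p
    ...   | inj₁ q = inj₁ (off x x≢a x≢b ◅ q)
    ...   | inj₂ q = inj₂ (off x x≢a x≢b ◅ q)

    avoiding : ∀ {x} → Orbit f x a → ¬ Orbit f x b → Orbit g x a
    avoiding ε _ = ε
    avoiding {x} (refl ◅ p) ¬xb with x ≟ a | x ≟ b
    ... | yes refl | _        = ε
    ... | no _     | yes refl = contradiction ε ¬xb
    ... | no x≢a   | no x≢b   = off x x≢a x≢b ◅ avoiding p (λ q → ¬xb (refl ◅ q))

    -- By `transfer`, whatever is no longer reached directly is reached from `f a` or `f b`. The old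
    -- path to `a` still arrives at `a` or `b`, whose image under `g` is one of these two points, so
    -- only the other becomes a new representative.
    cover-suc : ∀ {k} → Cover f k → Cover g (suc k)
    cover-suc {k} (r , c) with c a
    ... | i , p with first-hit p
    ...   | inj₁ q = r′ , c′
      where
      r′ : Fin (suc k) → D
      r′ zero    = f a
      r′ (suc j) = r j
      c′ : ∀ x → ∃[ j ] Orbit g (r′ j) x
      c′ x with c x
      ... | j , s with transfer s
      ...   | inj₁ t        = suc j , t
      ...   | inj₂ (inj₁ t) = zero , t
      ...   | inj₂ (inj₂ t) = suc i , q ◅◅ (at-a ◅ t)
    ...   | inj₂ q = r′ , c′
      where
      r′ : Fin (suc k) → D
      r′ zero    = f b
      r′ (suc j) = r j
      c′ : ∀ x → ∃[ j ] Orbit g (r′ j) x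
      c′ x with c x
      ... | j , s with transfer s
      ...   | inj₁ t        = suc j , t
      ...   | inj₂ (inj₁ t) = suc i , q ◅◅ (at-b ◅ t)
      ...   | inj₂ (inj₂ t) = zero , t

  exchange-sym : ∀ {f g : D → D} {a b} → Exchange f g a b → Exchange f g b a
  exchange-sym X = record
    { at-a = at-b ; at-b = at-a ; off = λ x p q → off x q p }
    where open Exchange X

  -- The orbit of `a` now makes a detour through all of the orbit of `b`, so `r i` takes over what
  -- `r j` represented and `r j` is dropped.
  cover-merge : DecidableEquality D → ∀ {f g : D → D} {a b} → Exchange f g a b →
                (∀ x → Orbit f (f x) x) → ¬ Orbit f a b →
                ∀ {k} → Cover f k → ∃[ l ] k ≡ suc l × Cover g l
  cover-merge _≟_ {f} {g} {a} {b} X rec ¬ab {zero} (r , c) with () ← proj₁ (c a)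
  cover-merge _≟_ {f} {g} {a} {b} X rec ¬ab {suc l} (r , c) = l , refl , r ∘ punchIn j , c′
    where
    open Exchange X
    module A = Exchanged _≟_ X
    module B = Exchanged _≟_ (exchange-sym X)
    i j : Fin (suc l)
    i = proj₁ (c a)
    j = proj₁ (c b)
    ia : Orbit f (r i) a
    ia = proj₂ (c a)
    jb : Orbit f (r j) b
    jb = proj₂ (c b)
    ai : Orbit f a (r i)
    ai = orbit-sym rec ia
    j≢i : j ≢ i
    j≢i j≡i = ¬ab (ai ◅◅ subst (λ k → Orbit f (r k) b) j≡i jb)
    -- The new walk from `r i` arrives at `a` as before, jumps to `f b`, goes round to `b` and jumps
    -- to `f a`. These are the starting points that `transfer` produces.
    i→fb : Orbit g (r i) (f b)
    i→fb = A.avoiding ia (λ p → ¬ab (ai ◅◅ p)) ◅◅ (at-a ◅ ε)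
    i→b : Orbit g (r i) b
    i→b = i→fb ◅◅ B.avoiding (rec b) (λ p → ¬ab (orbit-sym rec (refl ◅ p)))
    i→fa : Orbit g (r i) (f a)
    i→fa = i→b ◅◅ (at-b ◅ ε)
    i′ : r (punchIn j (punchOut j≢i)) ≡ r i
    i′ = cong r (punchIn-punchOut j≢i)
    via-i : ∀ {x} → Orbit g (r i) x → ∃[ k ] Orbit g (r (punchIn j k)) x
    via-i {x} p = punchOut j≢i , subst (λ z → Orbit g z x) (sym i′) p
    c′ : ∀ x → ∃[ k ] Orbit g (r (punchIn j k)) x
    c′ x with c x
    ... | k , s with j Finₚ.≟ k
    ...   | yes refl with A.transfer (orbit-sym rec jb ◅◅ s)
    ...     | inj₁ t        = via-i (i→b ◅◅ t)
    ...     | inj₂ (inj₁ t) = via-i (i→fa ◅◅ t)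
    ...     | inj₂ (inj₂ t) = via-i (i→fb ◅◅ t)
    c′ x | k , s | no j≢k with A.transfer s
    ...     | inj₁ t        = punchOut j≢k , subst (λ z → Orbit g (r z) x) (sym (punchIn-punchOut j≢k)) t
    ...     | inj₂ (inj₁ t) = via-i (i→fa ◅◅ t)
    ...     | inj₂ (inj₂ t) = via-i (i→fb ◅◅ t)

-- Rooted trees and breadth-first search

record RootedTree (n : ℕ) : Set where
  field
    root         : Fin n
    parent       : Fin n → Fin n
    depth        : Fin n → ℕ
    depth-root   : depth root ≡ 0
    depth-parent : ∀ {v} → v ≢ root → depth v ≡ suc (depth (parent v))

  data _≼_ (x : Fin n) : Fin n → Set where
    here : x ≼ x
    up   : ∀ {v} → v ≢ root → x ≼ parent v → x ≼ v

  parent-depth : ∀ {v} → v ≢ root → depth (parent v) < depth v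
  parent-depth r = ≤-reflexive (sym (depth-parent r))

  depth-induction : ∀ {ℓ} (P : Fin n → Set ℓ) → P root →
                    (∀ {v} → v ≢ root → P (parent v) → P v) → ∀ v → P v
  depth-induction P base step v = go (depth v) v ≤-refl
    where
    go : ∀ k v → depth v ≤ k → P v
    go k v d≤k with v Finₚ.≟ root
    go k       v d≤k | yes refl  = base
    go zero    v d≤k | no v≢root = contradiction (≤-trans (parent-depth v≢root) d≤k) λ ()
    go (suc k) v d≤k | no v≢root =
      step v≢root (go k (parent v) (s≤s⁻¹ (≤-trans (parent-depth v≢root) d≤k)))

  ≼-root : ∀ {x} → x ≼ root → x ≡ root
  ≼-root here     = refl
  ≼-root (up v _) = contradiction refl v

  root-≼ : ∀ v → root ≼ v
  root-≼ = depth-induction (root ≼_) here up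

  parent-≼ : ∀ {v} → v ≢ root → parent v ≼ v
  parent-≼ v≢root = up v≢root here

  ≼-parent : ∀ {x v} → x ≼ v → x ≢ v → x ≼ parent v
  ≼-parent here      x≢v = contradiction refl x≢v
  ≼-parent (up _ x≼) _   = x≼

  ≼-trans : ∀ {x y z} → x ≼ y → y ≼ z → x ≼ z
  ≼-trans x≼y here       = x≼y
  ≼-trans x≼y (up r y≼z) = up r (≼-trans x≼y y≼z)

  ≼-depth : ∀ {x v} → x ≼ v → depth x ≤ depth v
  ≼-depth here      = ≤-refl
  ≼-depth (up r x≼) = ≤-trans (≼-depth x≼) (<⇒≤ (parent-depth r))

  ⋠-parent : ∀ {v} → v ≢ root → ¬ v ≼ parent v
  ⋠-parent r v≼ = <⇒≱ (parent-depth r) (≼-depth v≼)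

  -- The parent chain of `v` loses one unit of depth per step. This is why a path brings at most one
  -- vertex into each layer.
  ≼-unique : ∀ {x y v} → x ≼ v → y ≼ v → depth x ≡ depth y → x ≡ y
  ≼-unique here      here      _  = refl
  ≼-unique here      (up r y≼) eq =
    contradiction (≤-trans (≤-reflexive eq) (≼-depth y≼)) (<⇒≱ (parent-depth r))
  ≼-unique (up r x≼) here      eq =
    contradiction (≤-trans (≤-reflexive (sym eq)) (≼-depth x≼)) (<⇒≱ (parent-depth r))
  ≼-unique (up _ x≼) (up _ y≼) eq = ≼-unique x≼ y≼ eq

  _≼?_ : ∀ x v → Dec (x ≼ v)
  x ≼? v = depth-induction (λ v → Dec (x ≼ v)) base step v
    where
    base : Dec (x ≼ root)
    base with x Finₚ.≟ root
    ... | yes refl = yes here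
    ... | no x≢    = no (x≢ ∘ ≼-root)
    step : ∀ {v} → v ≢ root → Dec (x ≼ parent v) → Dec (x ≼ v)
    step r (yes p) = yes (up r p)
    step {v} r (no ¬p) with x Finₚ.≟ v
    ... | yes refl = yes here
    ... | no x≢v   = no λ x≼v → ¬p (≼-parent x≼v x≢v)

record LayeredTree {n : ℕ} (G : Graph n) : Set where
  open Graph G
  field
    tree : RootedTree n
  open RootedTree tree public
  field
    tree-edge : ∀ {v} → v ≢ root → v ~ parent v
    layered   : ∀ {x y} → x ~ y → depth x ≤ suc (depth y)

module _ {n : ℕ} (G : Graph n) where
  open Graph G

  ~-sym : ∀ {x y} → x ~ y → y ~ x
  ~-sym {x} {y} = subst T (symm x y)

  ~-irrefl : ∀ {x} → ¬ x ~ x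
  ~-irrefl {x} = subst T (irrefl x)

  module _ (r : Fin n) where

    Walk : ℕ → Fin n → Set
    Walk zero    v = v ≡ r
    Walk (suc k) v = ∃[ u ] v ~ u × Walk k u

    walk? : ∀ k v → Dec (Walk k v)
    walk? zero    v = v Finₚ.≟ r
    walk? (suc k) v = any? λ u → T? (adj v u) ×-dec walk? k u

    connects⇒walk : ∀ {v} → Connects v r → ∃[ k ] Walk k v
    connects⇒walk ε = 0 , refl
    connects⇒walk (e ◅ p) = suc (proj₁ (connects⇒walk p)) , _ , e , proj₂ (connects⇒walk p)

  -- The depth is the distance to `r`, and the parent is the second vertex of a chosen shortest
  -- walk. Prefixing an edge to a shortest walk gives `layered`.
  bfsTree : Connected G → (r : Fin n) → LayeredTree G
  bfsTree conn r = record
    { tree = record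
      { root         = r
      ; parent       = λ v → pick v (dist v) (proj₁ (proj₂ (shortest v)))
      ; depth        = dist
      ; depth-root   = n≤0⇒n≡0 (dist-min 0 refl)
      ; depth-parent = λ {v} → step v (dist v) (proj₁ (proj₂ (shortest v))) refl
      }
    ; tree-edge = λ {v} → pick-edge v (dist v) (proj₁ (proj₂ (shortest v)))
    ; layered   = λ {x} {y} e → dist-min (suc (dist y)) (y , e , proj₁ (proj₂ (shortest y)))
    }
    where
    shortest : ∀ v → Σ[ m ∈ ℕ ] Walk r m v × m ≤ _ × (∀ {j} → j < m → ¬ Walk r j v)
    shortest v = least (λ k → walk? r k v) _ (proj₂ (connects⇒walk r (conn v r)))
    dist : Fin n → ℕ
    dist v = proj₁ (shortest v)
    dist-min : ∀ k {v} → Walk r k v → dist v ≤ k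
    dist-min k {v} w = ≮⇒≥ λ k<d → proj₂ (proj₂ (proj₂ (shortest v))) k<d w
    pick : ∀ v k → Walk r k v → Fin n
    pick v zero    _ = v
    pick v (suc k) (u , _) = u
    pick-edge : ∀ v k (w : Walk r k v) → v ≢ r → v ~ pick v k w
    pick-edge v zero    w           v≢r = contradiction w v≢r
    pick-edge v (suc k) (u , e , _) v≢r = e
    step : ∀ v k (w : Walk r k v) → dist v ≡ k → v ≢ r → k ≡ suc (dist (pick v k w))
    step v zero    w           _  v≢r = contradiction w v≢r
    step v (suc k) (u , e , w) eq v≢r = ≤-antisym
      (≤-trans (≤-reflexive (sym eq)) (dist-min (suc (dist u)) (u , e , proj₁ (proj₂ (shortest u)))))
      (s≤s (dist-min k w))

-- Chordal graphs

module _ {n : ℕ} {R : Fin n → Fin n → Set} (R? : ∀ x y → Dec (R x y))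
         (R-sym : ∀ {x y} → R x y → R y x) (R-irrefl : ∀ {x} → ¬ R x x) where

  graphOf : Graph n
  graphOf = record
    { adj    = λ x y → isYes (R? x y)
    ; symm   = λ x y → symm′ (R? x y) (R? y x)
    ; irrefl = λ x → irrefl′ (R? x x)
    }
    where
    symm′ : ∀ {x y} (d : Dec (R x y)) (e : Dec (R y x)) → isYes d ≡ isYes e
    symm′ (yes _) (yes _) = refl
    symm′ (no _)  (no _)  = refl
    symm′ (yes p) (no ¬q) = contradiction (R-sym p) ¬q
    symm′ (no ¬p) (yes q) = contradiction (R-sym q) ¬p
    irrefl′ : ∀ {x} (d : Dec (R x x)) → isYes d ≡ false
    irrefl′ (yes p) = contradiction p R-irrefl
    irrefl′ (no _)  = refl

  graphOf⁺ : ∀ {x y} → R x y → Graph._~_ graphOf x y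
  graphOf⁺ {x} {y} = fromWitness {a? = R? x y}

  graphOf⁻ : ∀ {x y} → Graph._~_ graphOf x y → R x y
  graphOf⁻ {x} {y} = toWitness {a? = R? x y}

next-exists : ∀ {k} (i : Fin k) → ∃[ j ] Next i j
next-exists {suc k} i with toℕ i <? k
... | yes i<k = fromℕ< (s≤s i<k) , inj₁ (toℕ-fromℕ< (s≤s i<k))
... | no  i≮k = zero , inj₂ (cong suc (≤-antisym (s≤s⁻¹ (toℕ<n i)) (≮⇒≥ i≮k)) , refl)

prev-exists : ∀ {k} (j : Fin k) → ∃[ i ] Next i j
prev-exists {suc k} zero    = fromℕ< (n<1+n k) , inj₂ (cong suc (toℕ-fromℕ< (n<1+n k)) , refl)
prev-exists {suc k} (suc j) = Fin.inject₁ j , inj₁ (cong suc (sym (Finₚ.toℕ-inject₁ j)))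

next-mod : ∀ {k} {i j : Fin k} → Next i j → ∃[ c ] suc (toℕ i) ≡ toℕ j + c * k
next-mod {k} {i} {j} (inj₁ j≡1+i)       = 0 , trans (sym j≡1+i) (sym (+-identityʳ (toℕ j)))
next-mod {k} {i} {j} (inj₂ (1+i≡k , j≡0)) = 1 , trans 1+i≡k (trans (sym (+-identityʳ k)) (cong (_+ 1 * k) (sym j≡0)))

-- Two neighbours a, b of a position i of a k-cycle differ by 2 modulo k, so if they are equal or
-- consecutive then k divides 1, 2 or 3.
neighbours-apart : ∀ {k} {a i b : Fin k} → 4 ≤ k → Next a i → Next i b →
                   a ≢ b × ¬ Next b a × ¬ Next a b
neighbours-apart {k} {a} {i} {b} 4≤k ai ib with next-mod ai | next-mod ib
... | c , eq | d , eq′ = a≢b , ¬ba , ¬ab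
  where
  open ≡-Reasoning
  2+a : 2 + toℕ a ≡ toℕ b + (c + d) * k
  2+a = begin
    2 + toℕ a                  ≡⟨ cong suc eq ⟩
    suc (toℕ i) + c * k        ≡⟨ cong (_+ c * k) eq′ ⟩
    (toℕ b + d * k) + c * k    ≡⟨ solve 4 (λ b c d k → (b :+ d :* k) :+ c :* k := b :+ (c :+ d) :* k)
                                     refl (toℕ b) c d k ⟩
    toℕ b + (c + d) * k        ∎
    where open +-*-Solver
  small : ∀ r → suc r < 4 → ¬ k ∣ suc r
  small r r<4 k∣r = <-irrefl refl (≤-trans r<4 (≤-trans 4≤k (∣⇒≤ k∣r)))
  a≢b : a ≢ b
  a≢b refl = small 1 (s≤s (s≤s (s≤s z≤n))) (divides (c + d)
    (+-cancelʳ-≡ (toℕ a) 2 ((c + d) * k) (trans 2+a (+-comm (toℕ a) _))))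
  ¬ba : ¬ Next b a
  ¬ba ba with next-mod ba
  ... | e , eq″ = small 2 ≤-refl (divides (e + (c + d)) (trans
    (+-cancelʳ-≡ (toℕ a) 3 (e * k + (c + d) * k) (begin
      3 + toℕ a                          ≡⟨ cong suc 2+a ⟩
      suc (toℕ b) + (c + d) * k          ≡⟨ cong (_+ (c + d) * k) eq″ ⟩
      (toℕ a + e * k) + (c + d) * k      ≡⟨ +-assoc (toℕ a) _ _ ⟩
      toℕ a + (e * k + (c + d) * k)      ≡⟨ +-comm (toℕ a) _ ⟩
      (e * k + (c + d) * k) + toℕ a      ∎))
    (sym (*-distribʳ-+ k e (c + d)))))
  ¬ab : ¬ Next a b
  ¬ab ab with next-mod ab
  ... | e , eq″ = small 0 (s≤s (s≤s z≤n)) (∣m+n∣m⇒∣n (divides (c + d)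
    (+-cancelˡ-≡ (toℕ b) (e * k + 1) ((c + d) * k) (begin
      toℕ b + (e * k + 1)      ≡⟨ sym (+-assoc (toℕ b) (e * k) 1) ⟩
      (toℕ b + e * k) + 1      ≡⟨ +-comm (toℕ b + e * k) 1 ⟩
      suc (toℕ b + e * k)      ≡⟨ cong suc (sym eq″) ⟩
      2 + toℕ a                ≡⟨ 2+a ⟩
      toℕ b + (c + d) * k      ∎)))
    (divides e refl))

-- All stages live on `Fin n`, so adding a vertex means giving the isolated vertex `x` the clique
-- `B` as its neighbourhood.
module AddSimplicial {n : ℕ} (H : Graph n) (x : Fin n) (B : Fin n → Set) (B? : ∀ y → Dec (B y))
    (fresh : ∀ {y} → ¬ Graph._~_ H x y) (x∉B : ¬ B x)
    (B-clique : ∀ {y z} → B y → B z → y ≢ z → Graph._~_ H y z) where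
  open Graph H using (_~_; adj)

  _≈_ : Fin n → Fin n → Set
  y ≈ z = y ~ z ⊎ (y ≡ x × B z) ⊎ (z ≡ x × B y)

  ≈-sym : ∀ {y z} → y ≈ z → z ≈ y
  ≈-sym (inj₁ e)        = inj₁ (~-sym H e)
  ≈-sym (inj₂ (inj₁ p)) = inj₂ (inj₂ p)
  ≈-sym (inj₂ (inj₂ p)) = inj₂ (inj₁ p)

  ≈-irrefl : ∀ {y} → ¬ y ≈ y
  ≈-irrefl (inj₁ e)                 = ~-irrefl H e
  ≈-irrefl (inj₂ (inj₁ (refl , b))) = x∉B b
  ≈-irrefl (inj₂ (inj₂ (refl , b))) = x∉B b

  ≈? : ∀ y z → Dec (y ≈ z)
  ≈? y z = T? (adj y z) ⊎-dec ((y Finₚ.≟ x) ×-dec B? z) ⊎-dec ((z Finₚ.≟ x) ×-dec B? y)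

  graph : Graph n
  graph = graphOf ≈? ≈-sym (λ {y} → ≈-irrefl {y})

  graph⁺ : ∀ {y z} → y ≈ z → Graph._~_ graph y z
  graph⁺ = graphOf⁺ ≈? ≈-sym (λ {y} → ≈-irrefl {y})

  graph⁻ : ∀ {y z} → Graph._~_ graph y z → y ≈ z
  graph⁻ = graphOf⁻ ≈? ≈-sym (λ {y} → ≈-irrefl {y})

  old : ∀ {y z} → y ≢ x → z ≢ x → y ≈ z → y ~ z
  old y≢x z≢x (inj₁ e)              = e
  old y≢x z≢x (inj₂ (inj₁ (p , _))) = contradiction p y≢x
  old y≢x z≢x (inj₂ (inj₂ (p , _))) = contradiction p z≢x

  neighbour : ∀ {y} → x ≈ y → B y
  neighbour (inj₁ e)                 = contradiction e fresh
  neighbour (inj₂ (inj₁ (_ , b)))    = b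
  neighbour (inj₂ (inj₂ (refl , b))) = b

  -- On an induced cycle through `x` the two neighbours of `x` lie in the clique `B` and are
  -- adjacent, but in a cycle of length at least four they are not consecutive.
  chordal : Chordal H → Chordal graph
  chordal H-chordal k 4≤k C with any? (λ i → vertex i Finₚ.≟ x)
    where open InducedCycle C
  ... | no avoids = H-chordal k 4≤k record
    { vertex    = vertex
    ; injective = injective
    ; cycle     = λ i j ij → old (λ e → avoids (i , e)) (λ e → avoids (j , e)) (graph⁻ (cycle i j ij))
    ; chordless = λ i j e → chordless i j (graph⁺ (inj₁ e))
    }
    where open InducedCycle C
  ... | yes (i , i≡x) with prev-exists i | next-exists i
  ...   | a , ai | b , ib with neighbours-apart 4≤k ai ib
  ...     | a≢b , ¬ba , ¬ab = [ ¬ab , ¬ba ]′ (chordless a b (graph⁺ (inj₁ (B-clique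
              (adjacent a (≈-sym (graph⁻ (cycle a i ai)))) (adjacent b (graph⁻ (cycle i b ib)))
              (λ e → a≢b (injective e))))))
    where
    open InducedCycle C
    adjacent : ∀ j → vertex i ≈ vertex j → B (vertex j)
    adjacent j e = neighbour (subst (_≈ vertex j) i≡x e)

-- Filling in the polygon traced out by a tour of a tree

Colour : Set
Colour = Fin 3

third-colour : ∀ (a b : Colour) → ∃[ c ] c ≢ a × c ≢ b
third-colour = toWitness
  {a? = all? λ (a : Colour) → all? λ (b : Colour) → any? λ c → ¬? (c Finₚ.≟ a) ×-dec ¬? (c Finₚ.≟ b)} _

-- Positions are the corners of the polygon, and several may carry the same vertex. Only a value
-- `mate i` greater than `i` is read as a chord; any other value means that no chord starts at `i`.
record Tour {n : ℕ} (tree : RootedTree n) : Set where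
  open RootedTree tree
  field
    last        : ℕ
    at          : ℕ → Fin n
    at-start    : at 0 ≡ root
    convex      : ∀ {x i j k} → i ≤ j → j ≤ k → k ≤ last → x ≼ at i → x ≼ at k → x ≼ at j
    mate        : ℕ → ℕ
    noncrossing : ∀ {p q r s} → p < q → q < r → r < s → s ≤ last → mate p ≡ r → mate q ≢ s

  Ends : ℕ → ℕ → Fin n → Set
  Ends i j x = x ≼ at i ⊎ x ≼ at j

  Joined : Fin n → Fin n → Set
  Joined x y = (∃[ i ] i ≤ last × x ≼ at i × y ≼ at i) ⊎
               (∃[ i ] ∃[ j ] i < j × j ≤ last × mate i ≡ j × Ends i j x × Ends i j y)

module _ {n : ℕ} (tree : RootedTree n) where
  open RootedTree tree

  -- A partially built `G₂`: by `supported`, the vertices not yet present are isolated.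
  record Stage : Set₁ where
    field
      graph     : Graph n
      present   : Fin n → Set
      present?  : Decidable present
      supported : ∀ {x y} → Graph._~_ graph x y → present x
      colour    : Fin n → Colour
      proper    : ∀ {x y} → Graph._~_ graph x y → depth x ≡ depth y → colour x ≢ colour y
      chordal   : Chordal graph
    open Graph graph public

  open Stage

  record Clique (σ : Stage) (P : Fin n → Set) : Set where
    field
      within   : ∀ {x} → P x → present σ x
      adjacent : ∀ {x y} → P x → P y → x ≢ y → _~_ σ x y
  open Clique

  record _⊑_ (σ τ : Stage) : Set where
    field
      present-mono : ∀ {x} → present σ x → present τ x
      edge-mono    : ∀ {x y} → _~_ σ x y → _~_ τ x y
  open _⊑_

  ⊑-refl : ∀ {σ} → σ ⊑ σ
  ⊑-refl = record { present-mono = id ; edge-mono = id }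

  ⊑-trans : ∀ {σ τ υ} → σ ⊑ τ → τ ⊑ υ → σ ⊑ υ
  ⊑-trans f g = record
    { present-mono = present-mono g ∘ present-mono f ; edge-mono = edge-mono g ∘ edge-mono f }

  clique-mono : ∀ {σ τ P Q} → σ ⊑ τ → (∀ {x} → Q x → P x) → Clique σ P → Clique τ Q
  clique-mono f Q⊆P c = record
    { within   = present-mono f ∘ within c ∘ Q⊆P
    ; adjacent = λ p q x≢y → edge-mono f (adjacent c (Q⊆P p) (Q⊆P q) x≢y)
    }

  Above : Fin n → Fin n → Fin n → Set
  Above a b x = x ≼ a ⊎ x ≼ b

  colour-above : ∀ (f : Fin n → Colour) a d → ∃[ c ] ∀ {y} → y ≼ a → depth y ≡ d → f y ≡ c
  colour-above f a d with any? (λ y → (y ≼? a) ×-dec (depth y ≟ d))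
  ... | yes (y , y≼a , dy) = f y , λ z≼a dz → cong f (≼-unique z≼a y≼a (trans dz (sym dy)))
  ... | no none            = zero , λ {y} y≼a dy → contradiction (y , y≼a , dy) none

  -- The new vertex v needs a colour different from those of the at most two vertices of its
  -- depth among its neighbours, one above a and one above b.
  module AddVertex (σ : Stage) {a b v : Fin n} (v≢root : v ≢ root) (v∉σ : ¬ present σ v)
      (κ : Clique σ (λ x → Above a b x ⊎ x ≼ parent v)) where

    Nbr : Fin n → Set
    Nbr x = Above a b x ⊎ x ≼ parent v

    Nbr? : Decidable Nbr
    Nbr? x = ((x ≼? a) ⊎-dec (x ≼? b)) ⊎-dec (x ≼? parent v)

    v∉Nbr : ¬ Nbr v
    v∉Nbr = v∉σ ∘ within κ

    open AddSimplicial (graph σ) v Nbr Nbr? (v∉σ ∘ supported σ) v∉Nbr (adjacent κ) public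
      using (_≈_; graph⁺; graph⁻) renaming (graph to graph′; chordal to chordal′)

    colour-a : ∃[ c ] ∀ {y} → y ≼ a → depth y ≡ depth v → colour σ y ≡ c
    colour-a = colour-above (colour σ) a (depth v)
    colour-b : ∃[ c ] ∀ {y} → y ≼ b → depth y ≡ depth v → colour σ y ≡ c
    colour-b = colour-above (colour σ) b (depth v)
    fresh-colour : ∃[ c ] c ≢ proj₁ colour-a × c ≢ proj₁ colour-b
    fresh-colour = third-colour (proj₁ colour-a) (proj₁ colour-b)

    colour′ : Fin n → Colour
    colour′ y with y Finₚ.≟ v
    ... | yes _ = proj₁ fresh-colour
    ... | no  _ = colour σ y

    nbr-colour : ∀ {y} → Nbr y → depth y ≡ depth v → proj₁ fresh-colour ≢ colour σ y
    nbr-colour (inj₁ (inj₁ y≼a)) dy eq = proj₁ (proj₂ fresh-colour) (trans eq (proj₂ colour-a y≼a dy))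
    nbr-colour (inj₁ (inj₂ y≼b)) dy eq = proj₂ (proj₂ fresh-colour) (trans eq (proj₂ colour-b y≼b dy))
    nbr-colour (inj₂ y≼p)        dy eq =
      <-irrefl dy (≤-trans (s≤s (≼-depth y≼p)) (≤-reflexive (sym (depth-parent v≢root))))

    proper′ : ∀ {x y} → x ≈ y → depth x ≡ depth y → colour′ x ≢ colour′ y
    proper′ {x} {y} e d eq with x Finₚ.≟ v | y Finₚ.≟ v
    proper′ (inj₁ e)              d eq | no _     | no _ = proper σ e d eq
    proper′ (inj₂ (inj₁ (p , _))) d eq | no x≢v   | no _ = x≢v p
    proper′ (inj₂ (inj₂ (p , _))) d eq | no _     | no y≢v = y≢v p
    proper′ (inj₁ e)              d eq | yes refl | _        = v∉σ (supported σ e)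
    proper′ (inj₂ (inj₁ (_ , b))) d eq | yes refl | yes refl = v∉Nbr b
    proper′ (inj₂ (inj₁ (_ , b))) d eq | yes refl | no _     = nbr-colour b (sym d) eq
    proper′ (inj₂ (inj₂ (refl , b))) d eq | yes refl | _     = v∉Nbr b
    proper′ (inj₁ e)              d eq | no _ | yes refl = v∉σ (supported σ (~-sym (graph σ) e))
    proper′ (inj₂ (inj₁ (p , _))) d eq | no x≢v | yes refl = x≢v p
    proper′ (inj₂ (inj₂ (_ , b))) d eq | no _ | yes refl = nbr-colour b d (sym eq)

    supported′ : ∀ {x y} → x ≈ y → present σ x ⊎ x ≡ v
    supported′ (inj₁ e)              = inj₁ (supported σ e)
    supported′ (inj₂ (inj₁ (p , _))) = inj₂ p
    supported′ (inj₂ (inj₂ (_ , b))) = inj₁ (within κ b)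

    stage : Stage
    stage = record
      { graph     = graph′
      ; present   = λ x → present σ x ⊎ x ≡ v
      ; present?  = λ x → present? σ x ⊎-dec (x Finₚ.≟ v)
      ; supported = supported′ ∘ graph⁻
      ; colour    = colour′
      ; proper    = proper′ ∘ graph⁻
      ; chordal   = chordal′ (chordal σ)
      }

    ⊑-stage : σ ⊑ stage
    ⊑-stage = record { present-mono = inj₁ ; edge-mono = graph⁺ ∘ inj₁ }

    Nbr⁺ : Fin n → Set
    Nbr⁺ x = Above a b x ⊎ x ≼ v

    split : ∀ {x} → Nbr⁺ x → Nbr x ⊎ x ≡ v
    split (inj₁ p)          = inj₁ (inj₁ p)
    split (inj₂ here)       = inj₂ refl
    split (inj₂ (up _ x≼p)) = inj₁ (inj₂ x≼p)

    clique⁺ : Clique stage Nbr⁺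
    clique⁺ = record
      { within   = λ p → [ inj₁ ∘ within κ , inj₂ ]′ (split p)
      ; adjacent = λ p q x≢y → graph⁺ (adj′ (split p) (split q) x≢y)
      }
      where
      adj′ : ∀ {x y} → Nbr x ⊎ x ≡ v → Nbr y ⊎ y ≡ v → x ≢ y → x ≈ y
      adj′ (inj₁ p)    (inj₁ q)    x≢y = inj₁ (adjacent κ p q x≢y)
      adj′ (inj₁ p)    (inj₂ q)    _   = inj₂ (inj₂ (q , p))
      adj′ (inj₂ p)    (inj₁ q)    _   = inj₂ (inj₁ (p , q))
      adj′ (inj₂ refl) (inj₂ refl) x≢y = contradiction refl x≢y

  -- The missing vertices between the root and `v` are added from the top down, each joined to the
  -- ancestors of `a`, of `b` and of its parent. If `v` is already present, the hypothesis puts it,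
  -- and so all its ancestors, above `a` or `b`.
  addPath : ∀ (σ : Stage) {a b} → Clique σ (Above a b) → ∀ v →
            (∀ {x} → present σ x → x ≼ v → Above a b x) →
            Σ[ τ ∈ Stage ] σ ⊑ τ × Clique τ (λ x → Above a b x ⊎ x ≼ v) ×
                           (∀ {x} → present τ x → present σ x ⊎ x ≼ v)
  addPath σ {a} {b} κ = depth-induction _ base step
    where
    Goal : Fin n → Set₁
    Goal v = (∀ {x} → present σ x → x ≼ v → Above a b x) →
             Σ[ τ ∈ Stage ] σ ⊑ τ × Clique τ (λ x → Above a b x ⊎ x ≼ v) ×
                            (∀ {x} → present τ x → present σ x ⊎ x ≼ v)
    unchanged : ∀ {v} → Above a b v → Σ[ τ ∈ Stage ] σ ⊑ τ × Clique τ (λ x → Above a b x ⊎ x ≼ v) ×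
                            (∀ {x} → present τ x → present σ x ⊎ x ≼ v)
    unchanged v≼ = σ , ⊑-refl , clique-mono ⊑-refl absorb κ , inj₁
      where
      absorb : ∀ {x} → Above a b x ⊎ x ≼ _ → Above a b x
      absorb (inj₁ p)   = p
      absorb (inj₂ x≼v) = [ inj₁ ∘ ≼-trans x≼v , inj₂ ∘ ≼-trans x≼v ]′ v≼
    base : Goal root
    base _ = unchanged (inj₁ (root-≼ a))
    step : ∀ {v} → v ≢ root → Goal (parent v) → Goal v
    step {v} v≢root ih sep with present? σ v
    ... | yes v∈σ = unchanged (sep v∈σ here)
    ... | no v∉σ with ih (λ x∈σ x≼p → sep x∈σ (up v≢root x≼p))
    ...   | τ , σ⊑τ , κ′ , bound = stage , ⊑-trans σ⊑τ ⊑-stage , clique⁺ , bound′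
      where
      -- What the recursive call added lies above `parent v`, so `v` is still absent.
      open AddVertex τ v≢root (λ v∈τ → [ v∉σ , ⋠-parent v≢root ]′ (bound v∈τ)) κ′
      bound′ : ∀ {x} → present τ x ⊎ x ≡ v → present σ x ⊎ x ≼ v
      bound′ (inj₁ x∈τ)  = [ inj₁ , inj₂ ∘ up v≢root ]′ (bound x∈τ)
      bound′ (inj₂ refl) = inj₂ here

module _ {n : ℕ} {tree : RootedTree n} (tour : Tour tree) where
  open RootedTree tree
  open Tour tour

  Between : ℕ → ℕ → ℕ → Set
  Between p q j = p ≤ j × j ≤ q

  -- A triangle p < k < q may be cut off the interval from p to q: no pair other than p, q itself
  -- has its ends on different sides of k.
  record Apex (p q : ℕ) : Set where
    field
      k        : ℕ
      p<k      : p < k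
      k<q      : k < q
      separate : ∀ {i j} → p ≤ i → i < j → j ≤ q → mate i ≡ j →
                 j ≤ k ⊎ k ≤ i ⊎ (i ≡ p × j ≡ q)

  -- If the chord starting at `p` ends strictly inside, its end serves as `k`: a pair separated by
  -- it would cross that chord. Otherwise `suc p` serves, since it separates only pairs starting at
  -- `p`, and within the interval these can only end at `q`.
  apex : ∀ {p q} → suc p < q → q ≤ last → Apex p q
  apex {p} {q} p+1<q q≤last with p <? mate p | mate p <? q
  ... | yes p<m | yes m<q = record { k = mate p ; p<k = p<m ; k<q = m<q ; separate = sep }
    where
    sep : ∀ {i j} → p ≤ i → i < j → j ≤ q → mate i ≡ j →
          j ≤ mate p ⊎ mate p ≤ i ⊎ (i ≡ p × j ≡ q)
    sep {i} {j} p≤i i<j j≤q mi≡j with m≤n⇒m<n∨m≡n p≤i | j ≤? mate p | mate p ≤? i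
    ... | _         | yes j≤m | _       = inj₁ j≤m
    ... | _         | no _    | yes m≤i = inj₂ (inj₁ m≤i)
    ... | inj₂ refl | no j≰m  | no _    = contradiction (≤-reflexive (sym mi≡j)) j≰m
    ... | inj₁ p<i  | no j≰m  | no m≰i  =
      contradiction mi≡j (noncrossing p<i (≰⇒> m≰i) (≰⇒> j≰m) (≤-trans j≤q q≤last) refl)
  ... | yes p<m | no m≮q = record { k = suc p ; p<k = ≤-refl ; k<q = p+1<q ; separate = sep }
    where
    sep : ∀ {i j} → p ≤ i → i < j → j ≤ q → mate i ≡ j →
          j ≤ suc p ⊎ suc p ≤ i ⊎ (i ≡ p × j ≡ q)
    sep {i} {j} p≤i i<j j≤q mi≡j with m≤n⇒m<n∨m≡n p≤i
    ... | inj₁ p<i  = inj₂ (inj₁ p<i)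
    ... | inj₂ refl = inj₂ (inj₂ (refl , ≤-antisym j≤q (≤-trans (≮⇒≥ m≮q) (≤-reflexive mi≡j))))
  ... | no p≮m | _ = record { k = suc p ; p<k = ≤-refl ; k<q = p+1<q ; separate = sep }
    where
    sep : ∀ {i j} → p ≤ i → i < j → j ≤ q → mate i ≡ j →
          j ≤ suc p ⊎ suc p ≤ i ⊎ (i ≡ p × j ≡ q)
    sep {i} {j} p≤i i<j j≤q mi≡j with m≤n⇒m<n∨m≡n p≤i
    ... | inj₁ p<i  = inj₂ (inj₁ p<i)
    ... | inj₂ refl = contradiction (≤-trans i<j (≤-reflexive (sym mi≡j))) p≮m

  Outside : ℕ → ℕ → Fin n → Set
  Outside p q x = ∃[ j ] (j ≤ p ⊎ q ≤ j) × j ≤ last × x ≼ at j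

  record Filled (σ : Stage tree) (p q : ℕ) : Set₁ where
    field
      stage : Stage tree
      grows : _⊑_ tree σ stage
      bound : ∀ {x} → Stage.present stage x → Stage.present σ x ⊎ ∃[ j ] Between p q j × x ≼ at j
      paths : ∀ {i} → Between p q i → Clique tree stage (_≼ at i)
      pairs : ∀ {i j} → p ≤ i → i < j → j ≤ q → mate i ≡ j → Clique tree stage (Ends i j)

  fill-base : ∀ {p q} → p ≤ q → q ≤ suc p → ∀ σ → Clique tree σ (Ends p q) → Filled σ p q
  fill-base {p} {q} p≤q q≤1+p σ κ = record
    { stage = σ ; grows = ⊑-refl tree ; bound = inj₁ ; paths = paths ; pairs = pairs }
    where
    paths : ∀ {i} → Between p q i → Clique tree σ (_≼ at i)
    paths (p≤i , i≤q) with m≤n⇒m<n∨m≡n p≤i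
    ... | inj₂ refl = clique-mono tree (⊑-refl tree) inj₁ κ
    ... | inj₁ p<i with refl ← ≤-antisym i≤q (≤-trans q≤1+p p<i) = clique-mono tree (⊑-refl tree) inj₂ κ
    pairs : ∀ {i j} → p ≤ i → i < j → j ≤ q → mate i ≡ j → Clique tree σ (Ends i j)
    pairs {i} {j} p≤i i<j j≤q _
      with refl ← ≤-antisym p≤i (s≤s⁻¹ (≤-trans i<j (≤-trans j≤q q≤1+p)))
      with refl ← ≤-antisym j≤q (≤-trans q≤1+p i<j) = κ

  -- Cut off the triangle `p`, `k`, `q`, add the path to `at k`, then fill the two smaller intervals
  -- in turn; `d` is fuel bounding the length. The invariant `Outside` supplies, through `convex`,
  -- the separation hypothesis of `addPath`.
  fill : ∀ d {p q} → q ≤ d + p → p ≤ q → q ≤ last → ∀ σ → Clique tree σ (Ends p q) →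
         (∀ {x} → Stage.present σ x → Outside p q x) → Filled σ p q
  fill zero    {p} {q} q≤d+p p≤q q≤l σ κ out = fill-base p≤q (≤-trans q≤d+p (n≤1+n p)) σ κ
  fill (suc d) {p} {q} q≤d+p p≤q q≤l σ κ out with suc p <? q
  ... | no  p+1≮q = fill-base p≤q (≮⇒≥ p+1≮q) σ κ
  ... | yes p+1<q = record
    { stage = Right.stage
    ; grows = ⊑-trans tree σ⊑τ (⊑-trans tree Left.grows Right.grows)
    ; bound = bound
    ; paths = paths
    ; pairs = pairs
    }
    where
    open Apex (apex p+1<q q≤l)
    p≤k : p ≤ k
    p≤k = <⇒≤ p<k
    k≤q : k ≤ q
    k≤q = <⇒≤ k<q
    k≤l : k ≤ last
    k≤l = ≤-trans k≤q q≤l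
    -- Here `x` is above `at k` and above a corner beyond `p` or `q`; by convexity it is above the
    -- end in between.
    above-ends : ∀ {x} → Stage.present σ x → x ≼ at k → Ends p q x
    above-ends x∈σ x≼k with out x∈σ
    ... | j , inj₁ j≤p , j≤l , x≼j = inj₁ (convex j≤p p≤k k≤l x≼j x≼k)
    ... | j , inj₂ q≤j , j≤l , x≼j = inj₂ (convex k≤q q≤j j≤l x≼k x≼j)
    triangle : Σ[ τ ∈ Stage tree ] _⊑_ tree σ τ × Clique tree τ (λ x → Ends p q x ⊎ x ≼ at k) ×
               (∀ {x} → Stage.present τ x → Stage.present σ x ⊎ x ≼ at k)
    triangle = addPath tree σ κ (at k) above-ends
    τ : Stage tree
    τ = proj₁ triangle
    σ⊑τ : _⊑_ tree σ τ
    σ⊑τ = proj₁ (proj₂ triangle)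
    κτ : Clique tree τ (λ x → Ends p q x ⊎ x ≼ at k)
    κτ = proj₁ (proj₂ (proj₂ triangle))
    τ-bound : ∀ {x} → Stage.present τ x → Stage.present σ x ⊎ x ≼ at k
    τ-bound = proj₂ (proj₂ (proj₂ triangle))
    left-out : ∀ {x} → Stage.present τ x → Outside p k x
    left-out x∈τ with τ-bound x∈τ
    ... | inj₂ x≼k = k , inj₂ ≤-refl , k≤l , x≼k
    ... | inj₁ x∈σ with out x∈σ
    ...   | j , inj₁ j≤p , r = j , inj₁ j≤p , r
    ...   | j , inj₂ q≤j , r = j , inj₂ (≤-trans k≤q q≤j) , r
    left : Filled τ p k
    left = fill d (s≤s⁻¹ (≤-trans k<q q≤d+p)) p≤k k≤l τ
      (clique-mono tree (⊑-refl tree) [ inj₁ ∘ inj₁ , inj₂ ]′ κτ) left-out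
    module Left = Filled left
    -- Filling the left interval added only ancestors of corners up to `k`, which the right interval
    -- counts as outside.
    right-out : ∀ {x} → Stage.present Left.stage x → Outside k q x
    right-out x∈ with Left.bound x∈
    ... | inj₂ (j , (_ , j≤k) , x≼j) = j , inj₁ j≤k , ≤-trans j≤k k≤l , x≼j
    ... | inj₁ x∈τ with τ-bound x∈τ
    ...   | inj₂ x≼k = k , inj₁ ≤-refl , k≤l , x≼k
    ...   | inj₁ x∈σ with out x∈σ
    ...     | j , inj₁ j≤p , r = j , inj₁ (≤-trans j≤p p≤k) , r
    ...     | j , inj₂ q≤j , r = j , inj₂ q≤j , r
    right : Filled Left.stage k q
    right = fill d (≤-trans q≤d+p (≤-trans (≤-reflexive (sym (+-suc d p))) (+-monoʳ-≤ d p<k))) k≤q q≤l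
      Left.stage (clique-mono tree Left.grows [ inj₂ , inj₁ ∘ inj₂ ]′ κτ) right-out
    module Right = Filled right
    bound : ∀ {x} → Stage.present Right.stage x → Stage.present σ x ⊎ ∃[ j ] Between p q j × x ≼ at j
    bound x∈ with Right.bound x∈
    ... | inj₂ (j , (k≤j , j≤q) , x≼j) = inj₂ (j , (≤-trans p≤k k≤j , j≤q) , x≼j)
    ... | inj₁ x∈L with Left.bound x∈L
    ...   | inj₂ (j , (p≤j , j≤k) , x≼j) = inj₂ (j , (p≤j , ≤-trans j≤k k≤q) , x≼j)
    ...   | inj₁ x∈τ with τ-bound x∈τ
    ...     | inj₂ x≼k = inj₂ (k , (p≤k , k≤q) , x≼k)
    ...     | inj₁ x∈σ = inj₁ x∈σ
    paths : ∀ {i} → Between p q i → Clique tree Right.stage (_≼ at i)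
    paths {i} (p≤i , i≤q) with ≤-total i k
    ... | inj₁ i≤k = clique-mono tree Right.grows id (Left.paths (p≤i , i≤k))
    ... | inj₂ k≤i = Right.paths (k≤i , i≤q)
    pairs : ∀ {i j} → p ≤ i → i < j → j ≤ q → mate i ≡ j → Clique tree Right.stage (Ends i j)
    pairs p≤i i<j j≤q m with separate p≤i i<j j≤q m
    ... | inj₁ j≤k                 = clique-mono tree Right.grows id (Left.pairs p≤i i<j j≤k m)
    ... | inj₂ (inj₁ k≤i)          = Right.pairs k≤i i<j j≤q m
    ... | inj₂ (inj₂ (refl , refl)) =
      clique-mono tree (⊑-trans tree σ⊑τ (⊑-trans tree Left.grows Right.grows)) id κ

  start : Stage tree
  start = record
    { graph     = edgeless
    ; present   = _≡ root
    ; present?  = Finₚ._≟ root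
    ; supported = λ ()
    ; colour    = λ _ → zero
    ; proper    = λ ()
    ; chordal   = λ { (suc k) _ C → InducedCycle.cycle C zero _ (proj₂ (next-exists zero)) }
    }
    where
    edgeless : Graph n
    edgeless = record { adj = λ _ _ → false ; symm = λ _ _ → refl ; irrefl = λ _ → refl }

  start-clique : Clique tree start (Ends 0 0)
  start-clique = record
    { within   = is-root
    ; adjacent = λ p q x≢y → contradiction (trans (is-root p) (sym (is-root q))) x≢y
    }
    where
    is-root : ∀ {x} → Ends 0 0 x → x ≡ root
    is-root {x} = [ ≼-root ∘ subst (x ≼_) at-start , ≼-root ∘ subst (x ≼_) at-start ]′

  -- Adding the path to `at last` makes the side from `0` to `last` a clique, as `fill` requires.
  -- Only the root is present before, so nothing obstructs that path.
  completion : Σ[ τ ∈ Stage tree ] (∀ {i} → i ≤ last → Clique tree τ (_≼ at i)) ×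
               (∀ {i j} → i < j → j ≤ last → mate i ≡ j → Clique tree τ (Ends i j))
  completion with addPath tree start start-clique (at last) (λ { refl _ → inj₁ (root-≼ _) })
  ... | τ , _ , κ , bound = stage , (λ i≤l → paths (z≤n , i≤l)) , pairs z≤n
    where
    τ-outside : ∀ {x} → Stage.present τ x → Outside 0 last x
    τ-outside x∈τ with bound x∈τ
    ... | inj₁ refl = 0 , inj₁ z≤n , z≤n , root-≼ _
    ... | inj₂ x≼l  = last , inj₂ ≤-refl , ≤-refl , x≼l
    open Filled (fill last (≤-reflexive (sym (+-identityʳ last))) z≤n ≤-refl τ
      (clique-mono tree (⊑-refl tree) [ inj₁ ∘ inj₁ , inj₂ ]′ κ) τ-outside)

-- Boundary walks in embedded graphs

-- For `f` a single cycle: `δ` lists it from `r` without repetition, and `index` inverts the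
-- listing.
record Contour {D : Set} (f : D → D) (r : D) : Set where
  field
    last  : ℕ
  δ : ℕ → D
  δ = fold r f
  field
    δ-injective : ∀ {i j} → i < j → j ≤ last → δ i ≢ δ j
    index       : D → ℕ
    index≤last  : ∀ x → index x ≤ last
    δ-index     : ∀ x → δ (index x) ≡ x

-- `suc last` is the first positive return time to `r`; an earlier repetition would cancel to an
-- earlier return.
contour : ∀ {D : Set} → DecidableEquality D → ∀ {f : D → D} → Injective _≡_ _≡_ f → ∀ {r} →
          Orbit f (f r) r → (∀ x → Orbit f r x) → Contour f r
contour _≟_ {f} inj {r} rec all with orbit-fold rec
... | k , eq with least (λ j → fold r f (suc j) ≟ r) k (trans (sym (fold-shift f r k)) eq)
...   | l , closes , _ , minimal = record
  { last        = l
  ; δ-injective = δ-inj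
  ; index       = λ x → proj₁ (reduce (proj₁ (orbit-fold (all x))))
  ; index≤last  = λ x → proj₁ (proj₂ (reduce (proj₁ (orbit-fold (all x)))))
  ; δ-index     = λ x → trans (sym (proj₂ (proj₂ (reduce (proj₁ (orbit-fold (all x)))))))
                              (proj₂ (orbit-fold (all x)))
  }
  where
  δ-inj : ∀ {i j} → i < j → j ≤ l → fold r f i ≢ fold r f j
  δ-inj {i} {j} i<j j≤l eq with j ∸ i in d | fold-cancel inj r (<⇒≤ i<j) eq | m∸n≤m j i
  ... | zero  | _   | _    = contradiction (m∸n≡0⇒m≤n d) (<⇒≱ i<j)
  ... | suc p | per | p<j = minimal (≤-trans p<j j≤l) (sym per)
  reduce : ∀ k → ∃[ i ] i ≤ l × fold r f k ≡ fold r f i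
  reduce zero = 0 , z≤n , refl
  reduce (suc k) with reduce k
  ... | i , i≤l , eq with m≤n⇒m<n∨m≡n i≤l
  ...   | inj₁ i<l  = suc i , i<l , cong f eq
  ...   | inj₂ refl = 0 , z≤n , trans (cong f eq) closes

∣insert∣ : ∀ {m} (S : Subset m) e → lookup S e ≡ outside → ∣ S [ e ]≔ inside ∣ ≡ suc ∣ S ∣
∣insert∣ (outside ∷ S) zero    _  = refl
∣insert∣ (inside  ∷ S) (suc e) eq = cong suc (∣insert∣ S e eq)
∣insert∣ (outside ∷ S) (suc e) eq = ∣insert∣ S e eq

module _ {n : ℕ} {G : Graph n} where
  open Dart

  dart-≡ : ∀ {d e : Dart G} → source d ≡ source e → target d ≡ target e → d ≡ e
  dart-≡ {dart x y p} {dart _ _ q} refl refl = cong (dart x y) (T-irrelevant p q)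

  _≟ᵈ_ : DecidableEquality (Dart G)
  d ≟ᵈ e with source d Finₚ.≟ source e | target d Finₚ.≟ target e
  ... | yes p | yes q = yes (dart-≡ p q)
  ... | no ¬p | _     = no (¬p ∘ cong source)
  ... | _     | no ¬q = no (¬q ∘ cong target)

  code : Dart G → Fin (n * n)
  code d = combine (source d) (target d)

  code-injective : Injective _≡_ _≡_ code
  code-injective {d} {e} eq with combine-injective (source d) (target d) (source e) (target e) eq
  ... | p , q = dart-≡ p q

  reverse-involutive : ∀ (d : Dart G) → reverse G (reverse G d) ≡ d
  reverse-involutive d = dart-≡ refl refl

  recurrent : ∀ {f : Dart G → Dart G} → Injective _≡_ _≡_ f → ∀ d → Orbit f (f d) d
  recurrent = injective⇒recurrent code code-injective

module PlaneMap {n : ℕ} {G : Graph n} (P : Planar G) where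
  open Dart
  open Planar P public
  open RotationSystem rotation public
  open HasClasses edgeClasses public using () renaming (class to edgeOf)
  private
    module VC = HasClasses vertices
    module EC = HasClasses edgeClasses
    rev : Dart G → Dart G
    rev = reverse G

  next-injective : Injective _≡_ _≡_ next
  next-injective = recurrent⇒injective λ d → next-cyclic (next d) d (next-source d)

  edgeOf-reverse : ∀ d → edgeOf (rev d) ≡ edgeOf d
  edgeOf-reverse d = sym (Equivalence.to (EC.classifies d (rev d)) (inj₂ refl))

  edgeOf-same : ∀ {d e} → edgeOf d ≡ edgeOf e → SameEdge G d e
  edgeOf-same = Equivalence.from (EC.classifies _ _)

  turn : Subset E → Dart G → Dart G
  turn S d = if lookup S (edgeOf d) then rev d else d

  turn-in : ∀ S {d} → lookup S (edgeOf d) ≡ inside → turn S d ≡ rev d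
  turn-in S eq rewrite eq = refl

  turn-out : ∀ S {d} → lookup S (edgeOf d) ≡ outside → turn S d ≡ d
  turn-out S eq rewrite eq = refl

  turn-involutive : ∀ S d → turn S (turn S d) ≡ d
  turn-involutive S d with lookup S (edgeOf d) in eq
  ... | true  = trans (turn-in S (trans (cong (lookup S) (edgeOf-reverse d)) eq)) (reverse-involutive d)
  ... | false = turn-out S eq

  -- The boundary walk of the thickened subgraph with edge set S: it interpolates between the
  -- rotation at the vertices, S = ∅, and the face permutation, S = everything.
  walk : Subset E → Dart G → Dart G
  walk S d = next (turn S d)

  walk-in : ∀ S {d} → lookup S (edgeOf d) ≡ inside → walk S d ≡ faceStep d
  walk-in S = cong next ∘ turn-in S

  walk-out : ∀ S {d} → lookup S (edgeOf d) ≡ outside → walk S d ≡ next d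
  walk-out S = cong next ∘ turn-out S

  walk-injective : ∀ S → Injective _≡_ _≡_ (walk S)
  walk-injective S {x} {y} eq =
    trans (sym (turn-involutive S x)) (trans (cong (turn S) (next-injective eq)) (turn-involutive S y))

  walk-recurrent : ∀ S d → Orbit (walk S) (walk S d) d
  walk-recurrent S = recurrent (walk-injective S)

  insert : Subset E → Dart G → Subset E
  insert S d = S [ edgeOf d ]≔ inside

  insert-size : ∀ S d → lookup S (edgeOf d) ≡ outside → ∣ insert S d ∣ ≡ suc ∣ S ∣
  insert-size S d = ∣insert∣ S (edgeOf d)

  insert-other : ∀ S d {e} → edgeOf e ≢ edgeOf d → lookup (insert S d) (edgeOf e) ≡ lookup S (edgeOf e)
  insert-other S d e≢d = lookup∘update′ e≢d S inside

  -- Inserting an edge changes `turn` only at its two darts, which it swaps: the walk is composed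
  -- with a transposition.
  exchange : ∀ S d → lookup S (edgeOf d) ≡ outside → Exchange (walk S) (walk (insert S d)) d (rev d)
  exchange S d out = record
    { at-a = trans (walk-in S′ here) (sym (walk-out S rev-out))
    ; at-b = trans (trans (walk-in S′ rev-in) (cong next (reverse-involutive d))) (sym (walk-out S out))
    ; off  = λ x x≢d x≢d′ → cong next (turn-off x x≢d x≢d′)
    }
    where
    S′ : Subset E
    S′ = insert S d
    here : lookup S′ (edgeOf d) ≡ inside
    here = lookup∘update (edgeOf d) S inside
    rev-out : lookup S (edgeOf (rev d)) ≡ outside
    rev-out = trans (cong (lookup S) (edgeOf-reverse d)) out
    rev-in : lookup S′ (edgeOf (rev d)) ≡ inside
    rev-in = trans (cong (lookup S′) (edgeOf-reverse d)) here
    turn-off : ∀ x → x ≢ d → x ≢ rev d → turn S′ x ≡ turn S x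
    turn-off x x≢d x≢d′ = cong (λ b → if b then rev x else x) 
        (insert-other S d λ eq → distinct (edgeOf-same (sym eq)))
      where
      distinct : ¬ SameEdge G d x
      distinct (inj₁ d≡x)  = x≢d (sym d≡x)
      distinct (inj₂ d′≡x) = x≢d′ (sym d′≡x)

  insert-cover : ∀ S d → lookup S (edgeOf d) ≡ outside → ∀ {k} →
                 Cover (walk S) k → Cover (walk (insert S d)) (suc k)
  insert-cover S d out = Exchanged.cover-suc _≟ᵈ_ (exchange S d out)

  insert-merge : ∀ S d → lookup S (edgeOf d) ≡ outside → ¬ Orbit (walk S) d (rev d) → ∀ {k} →
                 Cover (walk S) k → ∃[ l ] k ≡ suc l × Cover (walk (insert S d)) l
  insert-merge S d out sep = cover-merge _≟ᵈ_ (exchange S d out) (walk-recurrent S) sep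

  cover-∅ : Cover (walk Subset.⊥) V
  cover-∅ = cover-resp walk-∅ ((λ c → proj₁ (VC.surjective c)) , λ d → VC.class d ,
      next-cyclic _ d (Equivalence.from (VC.classifies _ _) (proj₂ (VC.surjective (VC.class d)) refl)))
    where
    walk-∅ : ∀ d → next d ≡ walk Subset.⊥ d
    walk-∅ d = sym (walk-out Subset.⊥ (lookup-replicate (edgeOf d) outside))

  V≤n : V ≤ n
  V≤n = injective⇒≤ {f = λ c → source (proj₁ (VC.surjective c))} λ {c} {c′} eq →
    trans (sym (proj₂ (VC.surjective c) refl))
      (trans (Equivalence.to (VC.classifies _ _) eq) (proj₂ (VC.surjective c′) refl))

  -- Each of the remaining edges adds at most one walk, and once all are inserted the walks are the
  -- faces. The fuel `g` cannot run out, since `S` has at most `E` elements.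
  faces-bound : ∀ g S {k} → E < ∣ S ∣ + g → Cover (walk S) k → F + ∣ S ∣ ≤ k + E
  faces-bound zero    S E<S c = contradiction (∣p∣≤n S) (<⇒≱ (subst (E <_) (+-identityʳ ∣ S ∣) E<S))
  faces-bound (suc g) S {k} E<S c with any? (λ e → lookup S e Boolₚ.≟ outside)
  ... | no full = +-mono-≤ (classes≤cover faces (cover-resp walk-full c)) (∣p∣≤n S)
    where
    walk-full : ∀ d → walk S d ≡ faceStep d
    walk-full d = walk-in S (¬-not λ out → full (edgeOf d , out))
  ... | yes (e , out) with EC.surjective e
  ...   | d , eq with refl ← eq refl = begin
    F + ∣ S ∣               ≤⟨ s≤s⁻¹ (begin
      suc (F + ∣ S ∣)         ≡⟨ sym (+-suc F ∣ S ∣) ⟩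
      F + suc ∣ S ∣           ≡⟨ cong (F +_) (sym (insert-size S d out)) ⟩
      F + ∣ insert S d ∣      ≤⟨ faces-bound g (insert S d) room (insert-cover S d out c) ⟩
      suc (k + E)             ∎) ⟩
    k + E                   ∎
    where
    open ≤-Reasoning
    room : E < ∣ insert S d ∣ + g
    room = begin-strict
      E                       <⟨ E<S ⟩
      ∣ S ∣ + suc g           ≡⟨ +-suc ∣ S ∣ g ⟩
      suc ∣ S ∣ + g           ≡⟨ cong (_+ g) (sym (insert-size S d out)) ⟩
      ∣ insert S d ∣ + g      ∎

-- Substituting `V` for `k + m` in the last inequality and using `k ≤ 1` twice gives `V + F ≤ E`,
-- leaving no room for `2 * C`.
few-faces⇒C≡0 : ∀ V E F C {k m} → V + F ≡ E + 2 * C → k + m ≡ V → k ≤ 1 →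
                F + (2 + m) ≤ k + E → C ≡ 0
few-faces⇒C≡0 V E F C {k} {m} euler count k≤1 few =
  n≤0⇒n≡0 (≤-trans (m≤m+n C _) (+-cancelʳ-≤ (2 + E) (2 * C) 0 (begin
    2 * C + (2 + E)     ≡⟨ solve 2 (λ C E → con 2 :* C :+ (con 2 :+ E) :=
                                         con 2 :+ (E :+ con 2 :* C)) refl C E ⟩
    2 + (E + 2 * C)     ≡⟨ cong (2 +_) (sym euler) ⟩
    2 + (V + F)         ≡⟨ cong (λ v → 2 + (v + F)) (sym count) ⟩
    2 + ((k + m) + F)   ≡⟨ solve 3 (λ k m F → con 2 :+ ((k :+ m) :+ F) :=
                                           k :+ (F :+ (con 2 :+ m))) refl k m F ⟩
    k + (F + (2 + m))   ≤⟨ +-mono-≤ k≤1 (≤-trans few (+-monoˡ-≤ E k≤1)) ⟩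
    2 + E               ∎)))
  where
  open ≤-Reasoning
  open +-*-Solver

-- The boundary walk of a spanning tree

module SpanningTour {m : ℕ} {G : Graph (suc m)} (P : Planar G) (L : LayeredTree G)
    (root≡0 : LayeredTree.root L ≡ zero) (r₀ : Dart G)
    (r₀-root : Dart.source r₀ ≡ LayeredTree.root L) where
  open Dart
  open Graph G
  open LayeredTree L
  open PlaneMap P
  private
    rev : Dart G → Dart G
    rev = reverse G

  suc≢root : ∀ {i : Fin m} → suc i ≢ root
  suc≢root eq with () ← trans eq root≡0

  branch : ∀ {v} → v ≢ root → Dart G
  branch {v} r = dart v (parent v) (tree-edge r)

  -- If the two darts were reverse to each other, `u` and `v` would each be deeper than the other.
  branch-≢ : ∀ {u v} (r : u ≢ root) (s : v ≢ root) → u ≢ v → ¬ SameEdge G (branch r) (branch s)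
  branch-≢ r s u≢v (inj₁ eq) = u≢v (cong source eq)
  branch-≢ {u} {v} r s u≢v (inj₂ eq) = <-asym
    (≤-reflexive (sym (trans (depth-parent r) (cong (suc ∘ depth) (cong source eq)))))
    (≤-reflexive (sym (trans (depth-parent s) (cong (suc ∘ depth) (sym (cong target eq))))))

  Branching : Subset E → (Fin (suc m) → Set) → Set
  Branching S Q = ∀ {d} → lookup S (edgeOf d) ≡ inside →
                  ∃[ v ] Σ[ r ∈ v ≢ root ] Q v × SameEdge G (branch r) d

  -- The rotation keeps the source, so the walk changes vertex only along edges of `S`, which are
  -- tree edges. The only tree dart into the subtree below `v` leads from `parent v` to `v`.
  enter : ∀ S Q → Branching S Q → ∀ {v} d → ¬ v ≼ source d → v ≼ source (walk S d) →
          lookup S (edgeOf d) ≡ inside × Σ[ r ∈ v ≢ root ] rev (branch r) ≡ d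
  enter S Q br {v} d ¬v≼d v≼d′ with lookup S (edgeOf d) in eq
  ... | false = contradiction (subst (v ≼_) (next-source d) v≼d′) ¬v≼d
  ... | true with br eq
  ...   | u , r , _ , inj₁ refl = contradiction (up r (subst (v ≼_) (next-source (rev (branch r))) v≼d′)) ¬v≼d
  ...   | u , r , _ , inj₂ refl with v Finₚ.≟ u
  ...     | yes refl = refl , r , refl
  ...     | no v≢u   =
    contradiction (≼-parent (subst (v ≼_) (next-source (rev (rev (branch r)))) v≼d′) v≢u) ¬v≼d

  -- As long as the edge above `v` is missing, a walk starting at `parent v` never enters the
  -- subtree below `v`, where `branch r` starts.
  separated : ∀ S Q → Branching S Q → ∀ {v} (r : v ≢ root) → lookup S (edgeOf (branch r)) ≡ outside →
              ¬ Orbit (walk S) (rev (branch r)) (branch r)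
  separated S Q br {v} r out = λ o → go o (⋠-parent r) here
    where
    go : ∀ {x y} → Orbit (walk S) x y → ¬ v ≼ source x → ¬ v ≼ source y
    go ε ¬v≼x = ¬v≼x
    go {x} (refl ◅ o) ¬v≼x = go o λ v≼x′ → stays (enter S Q br x ¬v≼x v≼x′)
      where
      stays : ¬ (lookup S (edgeOf x) ≡ inside × Σ[ s ∈ v ≢ root ] rev (branch s) ≡ x)
      stays (ins , s , refl) with () ← trans (sym ins) (trans (cong (lookup S)
        (trans (edgeOf-reverse (branch s)) (cong edgeOf (dart-≡ {d = branch s} {e = branch r} refl refl)))) out)

  record Grown (i : ℕ) : Set where
    field
      S         : Subset E
      k         : ℕ
      size      : ∣ S ∣ ≡ i
      cover     : Cover (walk S) k
      count     : k + i ≡ V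
      branching : Branching S (λ v → toℕ v ≤ i)

  -- As the root is `zero`, the branches can be inserted in the numerical order of their child ends,
  -- whatever the depths. Each merges two walks, which keeps `k + i` equal to `V`.
  grow : ∀ i → i ≤ m → Grown i
  grow zero _ = record
    { S = Subset.⊥ ; k = V ; size = ∣⊥∣≡0 E ; cover = cover-∅ ; count = +-identityʳ V
    ; branching = λ {d} ins → contradiction (trans (sym ins) (lookup-replicate (edgeOf d) outside)) λ () }
  grow (suc i) i<m = record
    { S         = insert S b
    ; k         = proj₁ merged
    ; size      = trans (insert-size S b out) (cong suc size)
    ; cover     = proj₂ (proj₂ merged)
    ; count     = trans (+-suc _ i) (trans (cong (_+ i) (sym (proj₁ (proj₂ merged)))) count)
    ; branching = branching′
    }
    where
    open Grown (grow i (<⇒≤ i<m))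
    v : Fin (suc m)
    v = suc (fromℕ< i<m)
    toℕ-v : toℕ v ≡ suc i
    toℕ-v = cong suc (toℕ-fromℕ< i<m)
    v≢root : v ≢ root
    v≢root = suc≢root
    b : Dart G
    b = branch v≢root
    out : lookup S (edgeOf b) ≡ outside
    out = ¬-not λ ins → new (branching ins)
      where
      new : ¬ (∃[ u ] Σ[ r ∈ u ≢ root ] toℕ u ≤ i × SameEdge G (branch r) b)
      new (u , r , u≤i , same) =
        branch-≢ r v≢root (λ u≡v → <-irrefl (trans (cong toℕ u≡v) toℕ-v) (s≤s u≤i)) same
    merged : ∃[ l ] k ≡ suc l × Cover (walk (insert S b)) l
    merged = insert-merge S b out
      (separated S (λ u → toℕ u ≤ i) branching v≢root out ∘ orbit-sym (walk-recurrent S)) cover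
    branching′ : Branching (insert S b) (λ u → toℕ u ≤ suc i)
    branching′ {d} ins with edgeOf d Finₚ.≟ edgeOf b
    ... | yes d≡b = v , v≢root , ≤-reflexive toℕ-v , edgeOf-same (sym d≡b)
    ... | no  d≢b with branching (trans (sym (insert-other S b d≢b)) ins)
    ...   | u , r , u≤i , same = u , r , ≤-trans u≤i (n≤1+n i) , same

  module Spanning (grown : Grown m) where
    open Grown grown

    k≤1 : k ≤ 1
    k≤1 = +-cancelʳ-≤ m k 1 (≤-trans (≤-reflexive count) V≤n)

    single : ∀ d → Orbit (walk S) r₀ d
    single d = go k cover k≤1
      where
      go : ∀ k → Cover (walk S) k → k ≤ 1 → Orbit (walk S) r₀ d
      go zero       (_ , c) _ with () ← proj₁ (c r₀)
      go (suc zero) (_ , c) _ with c r₀ | c d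
      ... | zero , p | zero , q = orbit-sym (walk-recurrent S) p ◅◅ q
      go (suc (suc _)) _ (s≤s ())

    γ : Contour (walk S) r₀
    γ = contour _≟ᵈ_ (walk-injective S) (walk-recurrent S r₀) single

    Free : Dart G → Set
    Free d = lookup S (edgeOf d) ≡ outside

    -- If d and e crossed, adding the edge of d and then that of e to the tree would split and then
    -- merge, so that the remaining edges could not produce all the faces that Euler's formula demands.
    no-merge : ∀ {d e} → Free d → Free e → edgeOf e ≢ edgeOf d → ¬ ¬ Orbit (walk (insert S d)) e (rev e)
    no-merge {d} {e} d-free e-free e≢d sep =
      conclude (insert-merge (insert S d) e e-free′ sep (insert-cover S d d-free cover))
      where
      e-free′ : lookup (insert S d) (edgeOf e) ≡ outside
      e-free′ = trans (insert-other S d e≢d) e-free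
      S₂ : Subset E
      S₂ = insert (insert S d) e
      S₂-size : ∣ S₂ ∣ ≡ 2 + m
      S₂-size = trans (insert-size (insert S d) e e-free′)
        (cong suc (trans (insert-size S d d-free) (cong suc size)))
      -- The dart `d` lies in some component, so `C` is positive.
      no-components : Fin C → C ≢ 0
      no-components c C≡0 with () ← subst Fin C≡0 c
      few-faces : Cover (walk S₂) k → F + (2 + m) ≤ k + E
      few-faces c = subst (λ s → F + s ≤ k + E) S₂-size
        (faces-bound (suc E) S₂ (m≤n+m (suc E) ∣ S₂ ∣) c)
      conclude : ¬ (∃[ l ] suc k ≡ suc l × Cover (walk S₂) l)
      conclude (l , eq , c) = no-components (HasClasses.class components d)
        (few-faces⇒C≡0 V E F C euler count k≤1
          (few-faces (subst (Cover (walk S₂)) (sym (suc-injective eq)) c)))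

    module Traversal (γ : Contour (walk S) r₀) where
      open Contour γ

      at : ℕ → Fin (suc m)
      at i = source (δ i)

      δ-cancel : ∀ {i j} → i ≤ last → j ≤ last → δ i ≡ δ j → i ≡ j
      δ-cancel {i} {j} i≤l j≤l eq with <-cmp i j
      ... | tri< i<j _ _ = contradiction eq (δ-injective i<j j≤l)
      ... | tri≈ _ i≡j _ = i≡j
      ... | tri> _ _ j<i = contradiction (sym eq) (δ-injective j<i i≤l)

      -- The search runs backwards from `b` to the last entry into the subtree below `x`, and
      -- `enter` identifies the dart used there.
      entrance : ∀ {x a b} → a ≤ b → ¬ x ≼ at a → x ≼ at b →
                 ∃[ c ] a ≤ c × c < b × Σ[ r ∈ x ≢ root ] rev (branch r) ≡ δ c
      entrance {b = zero} z≤n ¬xa xb = contradiction xb ¬xa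
      entrance {x} {a} {suc b} a≤b ¬xa xb with m≤n⇒m<n∨m≡n a≤b | x ≼? at b
      ... | inj₂ refl | _ = contradiction xb ¬xa
      ... | inj₁ a<b  | no ¬xb =
        b , s≤s⁻¹ a<b , ≤-refl , proj₂ (enter S (λ u → toℕ u ≤ m) branching (δ b) ¬xb xb)
      ... | inj₁ a<b  | yes xb′ with entrance (s≤s⁻¹ a<b) ¬xa xb′
      ...   | c , a≤c , c<b , r = c , a≤c , ≤-trans c<b (n≤1+n b) , r

      -- The tour starts outside the subtree below x and can enter it only along the one dart from
      -- parent x to x.
      convex : ∀ {x i j k} → i ≤ j → j ≤ k → k ≤ last → x ≼ at i → x ≼ at k → x ≼ at j
      convex {x} {i} {j} {k} i≤j j≤k k≤l xi xk with x ≼? at j | x ≼? at 0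
      ... | yes xj | _      = xj
      ... | no _   | yes x0 =
        subst (_≼ at j) (sym (≼-root (subst (x ≼_) r₀-root x0))) (root-≼ (at j))
      ... | no ¬xj | no ¬x0 with entrance z≤n ¬x0 xi | entrance j≤k ¬xj xk
      ...   | c , _ , c<i , r , eq | d , j≤d , d<k , s , eq′ = contradiction
        (trans (sym eq) (trans (dart-≡ {d = rev (branch r)} {e = rev (branch s)} refl refl) eq′))
        (δ-injective (≤-trans c<i (≤-trans i≤j j≤d)) (≤-trans (<⇒≤ d<k) k≤l))

      -- Positions of tree darts get themselves as a default, which marks no chord.
      mate : ℕ → ℕ
      mate i = if lookup S (edgeOf (δ i)) then i else index (rev (δ i))

      mate-free : ∀ {i j} → i < j → mate i ≡ j → Free (δ i) × rev (δ i) ≡ δ j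
      mate-free {i} i<j eq with lookup S (edgeOf (δ i))
      ... | true  = contradiction eq (<⇒≢ i<j)
      ... | false = refl , trans (sym (δ-index _)) (cong δ eq)

      -- Inserting the edge of `δ p` closes the stretch from `suc p` to `r` into a walk of its own.
      -- It contains `q` but not `s`, so the edge of `δ q` would merge two walks, against
      -- `no-merge`.
      noncrossing : ∀ {p q r s} → p < q → q < r → r < s → s ≤ last → mate p ≡ r → mate q ≢ s
      noncrossing {p} {q} {r} {s} p<q q<r r<s s≤l p~r q~s
        with mate-free (<-trans p<q q<r) p~r | mate-free (<-trans q<r r<s) q~s
      ... | p-free , p→r | q-free , q→s = no-merge p-free q-free distinct separate
        where
        r≤l : r ≤ last
        r≤l = <⇒≤ (<-≤-trans r<s s≤l)
        q≤l : q ≤ last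
        q≤l = <⇒≤ (<-≤-trans q<r r≤l)
        distinct : edgeOf (δ q) ≢ edgeOf (δ p)
        distinct eq = not-same (edgeOf-same (sym eq))
          where
          not-same : ¬ SameEdge G (δ p) (δ q)
          not-same (inj₁ e) = δ-injective p<q q≤l e
          not-same (inj₂ e) = δ-injective q<r r≤l (trans (sym e) p→r)
        X : Exchange (walk S) (walk (insert S (δ p))) (δ p) (rev (δ p))
        X = exchange S (δ p) p-free
        trapped : ∀ {x y} → Orbit (walk (insert S (δ p))) x y →
                  ∀ {j} → p < j → j ≤ r → δ j ≡ x → ∃[ i ] i ≤ r × δ i ≡ y
        trapped ε {j} p<j j≤r eq = j , j≤r , eq
        trapped (refl ◅ o) {j} p<j j≤r refl with m≤n⇒m<n∨m≡n j≤r
        ... | inj₁ j<r  = trapped o (<-trans p<j (n<1+n j)) j<r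
          (sym (Exchange.off X (δ j) (λ e → δ-injective p<j (<⇒≤ (<-≤-trans j<r r≤l)) (sym e))
                                     (λ e → δ-injective j<r r≤l (trans e p→r))))
        -- Position `r` carries the reverse of `δ p`, so the new walk jumps from it back to `suc p`.
        ... | inj₂ refl = trapped o ≤-refl (<-trans p<q q<r)
          (sym (trans (cong (walk (insert S (δ p))) (sym p→r)) (Exchange.at-b X)))
        separate : ¬ Orbit (walk (insert S (δ p))) (δ q) (rev (δ q))
        separate o with trapped o p<q (<⇒≤ q<r) refl
        ... | i , i≤r , eq = <-irrefl
          (δ-cancel (≤-trans i≤r r≤l) s≤l (trans eq q→s)) (≤-<-trans i≤r r<s)

      tour : Tour tree
      tour = record
        { last = last ; at = at ; at-start = r₀-root ; convex = convex
        ; mate = mate ; noncrossing = noncrossing }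

      open Tour tour using (Joined)

      at-index : ∀ d → source d ≡ at (index d)
      at-index d = cong source (sym (δ-index d))

      joined-branch : ∀ {v} (r : v ≢ root) → ∃[ i ] i ≤ last × parent v ≼ at i × v ≼ at i
      joined-branch {v} r = index (branch r) , index≤last (branch r) ,
        subst (parent v ≼_) (at-index (branch r)) (parent-≼ r) , subst (v ≼_) (at-index (branch r)) here

      -- For a tree edge, both ends lie above the position of its branch. Any other edge is a chord
      -- between the positions of its two darts, listed from the smaller one.
      joined : ∀ {x y} → x ~ y → Joined x y
      joined {x} {y} x~y with lookup S (edgeOf (dart x y x~y)) in eq
      ... | true with branching eq
      ...   | v , r , _ , inj₁ refl with joined-branch r
      ...     | i , i≤l , p , q = inj₁ (i , i≤l , q , p)
      joined {x} {y} x~y | true | v , r , _ , inj₂ refl = inj₁ (joined-branch r)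
      joined {x} {y} x~y | false = chord
        where
        d : Dart G
        d = dart x y x~y
        x-at : x ≼ at (index d)
        x-at = subst (x ≼_) (at-index d) here
        y-at : y ≼ at (index (rev d))
        y-at = subst (y ≼_) (at-index (rev d)) here
        mate-index : ∀ e → Free e → mate (index e) ≡ index (rev e)
        mate-index e free rewrite δ-index e | free = refl
        chord : Joined x y
        chord with <-cmp (index d) (index (rev d))
        ... | tri< i<j _ _ = inj₂ (_ , _ , i<j , index≤last _ , mate-index d eq , inj₁ x-at , inj₂ y-at)
        ... | tri> _ _ j<i = inj₂ (_ , _ , j<i , index≤last _ ,
          trans (mate-index (rev d) (trans (cong (lookup S) (edgeOf-reverse d)) eq))
                (cong index (reverse-involutive d)) ,
          inj₂ x-at , inj₁ y-at)
        -- Equal positions would make `x` and `y` the same vertex.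
        ... | tri≈ _ i≡j _ = contradiction
          (subst (_~ y) (trans (at-index d) (trans (cong at i≡j) (sym (at-index (rev d))))) x~y)
          (~-irrefl G)

  spanningTour : Σ[ t ∈ Tour tree ] (∀ {x y} → x ~ y → Tour.Joined t x y)
  spanningTour = tour , joined
    where
    open Spanning (grow m ≤-refl)
    open Traversal γ

-- Clique cover width

module _ {n : ℕ} {G : Graph n} where
  open Graph G

  module _ (C : OrderedCliqueCover G) where
    open OrderedCliqueCover C

    width-≤ : ∀ {w} → (∀ {x y} → x ~ y → ∣ toℕ (part y) - toℕ (part x) ∣ ≤ w) → width ≤ w
    width-≤ bound = max≤v⁺ z≤n (Allₚ.map⁺ (All.map bound
      (Allₚ.all-filter (λ xy → T? (uncurry adj xy)) (cartesianProduct (allFin n) (allFin n)))))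

    ≤-width : ∀ {x y} → x ~ y → ∣ toℕ (part y) - toℕ (part x) ∣ ≤ width
    ≤-width {x} {y} x~y = All.lookup (xs≤max 0 _) (∈-map⁺ _
      (∈-filter⁺ (λ xy → T? (uncurry adj xy)) (∈-cartesianProduct⁺ (∈-allFin x) (∈-allFin y)) x~y))

  record Covers (w s : ℕ) (part : Fin n → Fin s) : Set where
    constructor covers
    field
      onto   : ∀ i → ∃[ x ] part x ≡ i
      clique : ∀ x y → part x ≡ part y → x ≢ y → x ~ y
      narrow : ∀ x y → x ~ y → ∣ toℕ (part y) - toℕ (part x) ∣ ≤ w

  covers? : ∀ w s part → Dec (Covers w s part)
  covers? w s part = map′ (λ (o , c , b) → covers o c b) (λ (covers o c b) → o , c , b)
    (all? (λ i → any? λ x → part x Finₚ.≟ i) ×-dec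
     all? (λ x → all? λ y → (part x Finₚ.≟ part y) →-dec (¬? (x Finₚ.≟ y) →-dec T? (adj x y))) ×-dec
     all? (λ x → all? λ y → T? (adj x y) →-dec (∣ toℕ (part y) - toℕ (part x) ∣ ≤? w)))

  covers-resp : ∀ {w s part part′} → (∀ x → part x ≡ part′ x) → Covers w s part → Covers w s part′
  covers-resp eq (covers o c b) = covers
    (λ i → proj₁ (o i) , trans (sym (eq _)) (proj₂ (o i)))
    (λ x y p → c x y (trans (eq x) (trans p (sym (eq y)))))
    (λ x y e → subst₂ (λ i j → ∣ toℕ j - toℕ i ∣ ≤ _) (eq x) (eq y) (b x y e))

  fromCovers : ∀ {w s part} → Covers w s part → Σ[ C ∈ OrderedCliqueCover G ] OrderedCliqueCover.width C ≤ w
  fromCovers {w} {s} {part} (covers o c b) = C , width-≤ C (b _ _)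
    where
    C : OrderedCliqueCover G
    C = record { size = s ; part = part ; clique = c
               ; surjective = λ i → proj₁ (o i) , λ { refl → proj₂ (o i) } }

  -- `IsCCW` asks for an exact minimum, so the existence of a cover of width at most `w` has to be
  -- decidable. Parts are nonempty, hence at most `n` in number, and `s` and the coded map `c` range
  -- over finite sets.
  Narrow : ℕ → Set
  Narrow w = ∃[ s ] ∃[ c ] Covers w (toℕ {suc n} s) (finToFun {toℕ s} {n} c)

  narrow? : Decidable Narrow
  narrow? w = any? λ s → any? λ c → covers? w (toℕ s) (finToFun c)

  toNarrow : ∀ {w} (C : OrderedCliqueCover G) → OrderedCliqueCover.width C ≤ w → Narrow w
  toNarrow {w} C C≤w = s , funToFin part′ , covers-resp (λ x → sym (finToFun-funToFin part′ x)) cov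
    where
    open OrderedCliqueCover C
    size≤n : size ≤ n
    size≤n = injective⇒≤ {f = proj₁ ∘ surjective} λ {i} {j} eq →
      trans (sym (proj₂ (surjective i) refl)) (trans (cong part eq) (proj₂ (surjective j) refl))
    s : Fin (suc n)
    s = fromℕ< (s≤s size≤n)
    resized : Σ (Fin n → Fin (toℕ s)) (Covers w (toℕ s))
    resized = subst (λ t → Σ (Fin n → Fin t) (Covers w t)) (sym (toℕ-fromℕ< (s≤s size≤n)))
      (part , covers (λ i → proj₁ (surjective i) , proj₂ (surjective i) refl) clique
                     (λ x y e → ≤-trans (≤-width C e) C≤w))
    part′ : Fin n → Fin (toℕ s)
    part′ = proj₁ resized
    cov : Covers w (toℕ s) part′
    cov = proj₂ resized

  ccw-attained : ∀ {w₀ s part} → Covers w₀ s part → Σ[ w ∈ ℕ ] IsCCW G w × w ≤ w₀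
  ccw-attained {w₀} cov with fromCovers cov
  ... | C₀ , C₀≤w₀ with least narrow? w₀ (toNarrow C₀ C₀≤w₀)
  ...   | w , (s , c , cov′) , w≤w₀ , minimal with fromCovers cov′
  ...     | C , C≤w = w , record { attained = C , ≤-antisym C≤w (smallest C) ; smallest = smallest } , w≤w₀
    where
    smallest : ∀ C → w ≤ OrderedCliqueCover.width C
    smallest C = ≮⇒≥ λ C<w → minimal C<w (toNarrow C ≤-refl)

-- Consecutive numbering of the occurring values

module Rank {n : ℕ} (value : Fin n → ℕ) where

  occurs? : ∀ u → Dec (∃[ x ] value x ≡ u)
  occurs? u = any? λ x → value x ≟ u

  -- The number of occurring values below the argument. Values that do not occur are squeezed out
  -- because classes must be nonempty, and this never increases a distance.
  rank : ℕ → ℕ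
  rank zero    = zero
  rank (suc u) with occurs? u
  ... | yes _ = suc (rank u)
  ... | no  _ = rank u

  rank-step : ∀ u → rank u ≤ rank (suc u)
  rank-step u with occurs? u
  ... | yes _ = n≤1+n _
  ... | no  _ = ≤-refl

  rank-step′ : ∀ u → rank (suc u) ≤ suc (rank u)
  rank-step′ u with occurs? u
  ... | yes _ = ≤-refl
  ... | no  _ = n≤1+n _

  rank-mono : ∀ {a b} → a ≤ b → rank a ≤ rank b
  rank-mono {a} {zero}  z≤n = ≤-refl
  rank-mono {a} {suc b} a≤b with m≤n⇒m<n∨m≡n a≤b
  ... | inj₁ a<b  = ≤-trans (rank-mono (s≤s⁻¹ a<b)) (rank-step b)
  ... | inj₂ refl = ≤-refl

  rank-strict : ∀ x {b} → value x < b → rank (value x) < rank b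
  rank-strict x {b} vx<b = ≤-trans (occurring (value x) (x , refl)) (rank-mono vx<b)
    where
    occurring : ∀ u → ∃[ x ] value x ≡ u → suc (rank u) ≤ rank (suc u)
    occurring u o with occurs? u
    ... | yes _ = ≤-refl
    ... | no ¬o = contradiction o ¬o

  rank-injective : ∀ x y → rank (value x) ≡ rank (value y) → value x ≡ value y
  rank-injective x y eq with <-cmp (value x) (value y)
  ... | tri< x<y _ _ = contradiction eq (<⇒≢ (rank-strict x x<y))
  ... | tri≈ _ x≡y _ = x≡y
  ... | tri> _ _ y<x = contradiction (sym eq) (<⇒≢ (rank-strict y y<x))

  rank-near : ∀ k {a b} → a ≤ k + b → rank a ≤ k + rank b
  rank-near k {a} {b} a≤k+b = ≤-trans (rank-mono a≤k+b) (go k)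
    where
    go : ∀ k → rank (k + b) ≤ k + rank b
    go zero    = ≤-refl
    go (suc k) = ≤-trans (rank-step′ (k + b)) (s≤s (go k))

  rank-onto : ∀ M {i} → i < rank M → ∃[ x ] value x < M × rank (value x) ≡ i
  rank-onto (suc M) {i} i<r with occurs? M
  ... | no _ with rank-onto M i<r
  ...   | x , x<M , eq = x , <-trans x<M (n<1+n M) , eq
  rank-onto (suc M) {i} i<r | yes (x , vx≡M) with m≤n⇒m<n∨m≡n (s≤s⁻¹ i<r)
  ...   | inj₂ refl = x , s≤s (≤-reflexive vx≡M) , cong rank vx≡M
  ...   | inj₁ i<r′ with rank-onto M i<r′
  ...     | y , y<M , eq = y , <-trans y<M (n<1+n M) , eq

bounded : ∀ {n} (f : Fin n → ℕ) → ∃[ M ] ∀ x → f x < M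
bounded {zero}  f = 0 , λ ()
bounded {suc n} f with bounded (f ∘ suc)
... | M , b = suc (f zero) + M , λ { zero → m≤m+n _ M ; (suc x) → ≤-trans (b x) (m≤n+m M _) }

∣-∣-≤ : ∀ {a b k} → a ≤ k + b → b ≤ k + a → ∣ a - b ∣ ≤ k
∣-∣-≤ {a} {b} {k} a≤ b≤ with ≤-total a b
... | inj₁ a≤b = ≤-trans (≤-reflexive (m≤n⇒∣m-n∣≡n∸m a≤b)) (m≤n+o⇒m∸n≤o b a (≤-trans b≤ (≤-reflexive (+-comm k a))))
... | inj₂ b≤a = ≤-trans (≤-reflexive (m≤n⇒∣n-m∣≡n∸m b≤a)) (m≤n+o⇒m∸n≤o a b (≤-trans a≤ (≤-reflexive (+-comm k b))))

T-ext : ∀ {a b : Bool} → (T a → T b) → (T b → T a) → a ≡ b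
T-ext {true}  {true}  _ _ = refl
T-ext {false} {false} _ _ = refl
T-ext {true}  {false} f _ = ⊥-elim (f _)
T-ext {false} {true}  _ g = ⊥-elim (g _)

-- Assembling the two graphs

Representable : ∀ {n} → Graph n → Set
Representable {n} G = Σ[ G₁ ∈ Graph n ] Σ[ G₂ ∈ Graph n ]
  ((Σ[ w ∈ ℕ ] (IsCCW G₁ w × w ≤ 7)) × Chordal G₂ × IsIntersection G G₁ G₂)

module Represent {n : ℕ} (G H : Graph n) (depth : Fin n → ℕ) (colour : Fin n → Colour)
    (layered : ∀ {x y} → Graph._~_ G x y → depth x ≤ suc (depth y))
    (G⊆H : ∀ {x y} → Graph._~_ G x y → Graph._~_ H x y)
    (proper : ∀ {x y} → Graph._~_ H x y → depth x ≡ depth y → colour x ≢ colour y)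
    (chordal : Chordal H) where
  open Graph G

  value : Fin n → ℕ
  value x = depth x * 3 + toℕ (colour x)

  value-layer : ∀ {x y} → depth x < depth y → value x < value y
  value-layer {x} {y} dx<dy = begin-strict
    depth x * 3 + toℕ (colour x)   <⟨ +-monoʳ-< (depth x * 3) (toℕ<n (colour x)) ⟩
    depth x * 3 + 3                ≡⟨ +-comm (depth x * 3) 3 ⟩
    suc (depth x) * 3              ≤⟨ *-monoˡ-≤ 3 dx<dy ⟩
    depth y * 3                    ≤⟨ m≤m+n _ _ ⟩
    value y                        ∎
    where open ≤-Reasoning

  value-injective : ∀ {x y} → value x ≡ value y → depth x ≡ depth y × colour x ≡ colour y
  value-injective {x} {y} eq with <-cmp (depth x) (depth y)
  ... | tri< dx<dy _ _ = contradiction eq (<⇒≢ (value-layer dx<dy))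
  ... | tri> _ _ dy<dx = contradiction (sym eq) (<⇒≢ (value-layer dy<dx))
  ... | tri≈ _ dx≡dy _ = dx≡dy , toℕ-injective
    (+-cancelˡ-≡ (depth y * 3) _ _ (trans (cong (λ d → d * 3 + toℕ (colour x)) (sym dx≡dy)) eq))

  -- One layer accounts for 3 and the colours for at most 2.
  value-near : ∀ {x y} → x ~ y → value x ≤ 5 + value y
  value-near {x} {y} x~y = begin
    depth x * 3 + toℕ (colour x)   ≤⟨ +-mono-≤ (*-monoˡ-≤ 3 (layered x~y)) (s≤s⁻¹ (toℕ<n (colour x))) ⟩
    (3 + depth y * 3) + 2          ≡⟨ cong (3 +_) (+-comm (depth y * 3) 2) ⟩
    5 + depth y * 3                ≤⟨ +-monoʳ-≤ 5 (m≤m+n _ _) ⟩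
    5 + value y                    ∎
    where open ≤-Reasoning

  _≈_ : Fin n → Fin n → Set
  x ≈ y = x ~ y ⊎ (x ≢ y × value x ≡ value y)

  ≈? : ∀ x y → Dec (x ≈ y)
  ≈? x y = T? (adj x y) ⊎-dec (¬? (x Finₚ.≟ y) ×-dec (value x ≟ value y))

  ≈-sym : ∀ {x y} → x ≈ y → y ≈ x
  ≈-sym (inj₁ e)         = inj₁ (~-sym G e)
  ≈-sym (inj₂ (x≢y , v)) = inj₂ ((λ e → x≢y (sym e)) , sym v)

  ≈-irrefl : ∀ {x} → ¬ x ≈ x
  ≈-irrefl (inj₁ e)         = ~-irrefl G e
  ≈-irrefl (inj₂ (x≢x , _)) = x≢x refl

  G₁ : Graph n
  G₁ = graphOf ≈? ≈-sym ≈-irrefl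

  G₁⁺ : ∀ {x y} → x ≈ y → Graph._~_ G₁ x y
  G₁⁺ = graphOf⁺ ≈? ≈-sym ≈-irrefl

  G₁⁻ : ∀ {x y} → Graph._~_ G₁ x y → x ≈ y
  G₁⁻ = graphOf⁻ ≈? ≈-sym ≈-irrefl

  open Rank value

  M : ℕ
  M = proj₁ (bounded value)

  part : Fin n → Fin (rank M)
  part x = fromℕ< (rank-strict x (proj₂ (bounded value) x))

  toℕ-part : ∀ x → toℕ (part x) ≡ rank (value x)
  toℕ-part x = toℕ-fromℕ< _

  ≈-near : ∀ {x y} → x ≈ y → value x ≤ 5 + value y
  ≈-near (inj₁ e)               = value-near e
  ≈-near {x} {y} (inj₂ (_ , v)) = ≤-trans (≤-reflexive v) (m≤n+m (value y) 5)

  G₁-covers : Covers {G = G₁} 5 (rank M) part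
  G₁-covers = record
    { onto   = λ i → let x , _ , eq = rank-onto M (toℕ<n i) in x , toℕ-injective (trans (toℕ-part x) eq)
    ; clique = λ x y eq x≢y → G₁⁺ (inj₂ (x≢y , rank-injective x y
        (trans (sym (toℕ-part x)) (trans (cong toℕ eq) (toℕ-part y)))))
    ; narrow = λ x y e → subst₂ (λ a b → ∣ a - b ∣ ≤ 5) (sym (toℕ-part y)) (sym (toℕ-part x))
        (∣-∣-≤ (rank-near 5 (≈-near (≈-sym (G₁⁻ e)))) (rank-near 5 (≈-near (G₁⁻ e))))
    }

  intersection : IsIntersection G G₁ H
  intersection x y = T-ext (λ e → Equivalence.from T-∧ (G₁⁺ (inj₁ e) , G⊆H e)) back
    where
    back : T (Graph.adj G₁ x y ∧ Graph.adj H x y) → x ~ y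
    back e with Equivalence.to (T-∧ {Graph.adj G₁ x y}) e
    ... | e₁ , e₂ with G₁⁻ e₁
    ...   | inj₁ x~y      = x~y
    ...   | inj₂ (_ , eq) = contradiction (proj₂ (value-injective eq)) (proper e₂ (proj₁ (value-injective eq)))

  represented : Representable G
  -- The construction gives 5; adding 2 yields the stated 7.
  represented = G₁ , H , (w , isCCW , ≤-trans w≤5 (m≤n+m 5 2)) , chordal , intersection
    where
    ccw : Σ[ w ∈ ℕ ] IsCCW G₁ w × w ≤ 5
    ccw = ccw-attained G₁-covers
    w : ℕ
    w = proj₁ ccw
    isCCW : IsCCW G₁ w
    isCCW = proj₁ (proj₂ ccw)
    w≤5 : w ≤ 5
    w≤5 = proj₂ (proj₂ ccw)

-- With at most one vertex there is no dart to start a tour from, but `G` has no edges and serves as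
-- its own chordal graph.
subsingleton-case : ∀ {n} → (∀ (x y : Fin n) → x ≡ y) → n ≤ 1 → (G : Graph n) → Representable G
subsingleton-case {n} all≡ n≤1 G = Represent.represented G G (λ _ → 0) (λ _ → zero)
  (λ _ → z≤n) id (λ {x} {y} e _ _ → ~-irrefl G (subst (Graph._~_ G x) (all≡ y x) e))
  (λ k 4≤k cyc → <-irrefl refl (≤-trans (s≤s (injective⇒≤ (InducedCycle.injective cyc)))
    (≤-trans (s≤s n≤1) (≤-trans (s≤s (s≤s z≤n)) 4≤k))))

tour-case : ∀ {n} (G : Graph n) (L : LayeredTree G) (t : Tour (LayeredTree.tree L)) →
  (∀ {x y} → Graph._~_ G x y → Tour.Joined t x y) → Representable G
tour-case {n} G L t joined = represented
  where
  open Graph G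
  open LayeredTree L
  open Tour t
  τ : Stage tree
  τ = proj₁ (completion t)
  paths : ∀ {i} → i ≤ last → Clique tree τ (_≼ at i)
  paths = proj₁ (proj₂ (completion t))
  pairs : ∀ {i j} → i < j → j ≤ last → mate i ≡ j → Clique tree τ (Ends i j)
  pairs = proj₂ (proj₂ (completion t))
  G⊆τ : ∀ {x y} → x ~ y → Graph._~_ (Stage.graph τ) x y
  G⊆τ x~y with joined x~y
  ... | inj₁ (i , i≤l , p , q)               = Clique.adjacent (paths i≤l) p q λ { refl → ~-irrefl G x~y }
  ... | inj₂ (i , j , i<j , j≤l , m , p , q) = Clique.adjacent (pairs i<j j≤l m) p q λ { refl → ~-irrefl G x~y }
  open Represent G (Stage.graph τ) depth (Stage.colour τ) layered G⊆τ (Stage.proper τ) (Stage.chordal τ)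

theorem5 : ∀ {n : ℕ} (G : Graph n) → Connected G → Planar G →
    Σ[ G₁ ∈ Graph n ] Σ[ G₂ ∈ Graph n ]
    ((Σ[ w ∈ ℕ ] (IsCCW G₁ w × w ≤ 7)) × Chordal G₂ × IsIntersection G G₁ G₂)
theorem5 {zero}        G conn P = subsingleton-case (λ ()) z≤n G
theorem5 {suc zero}    G conn P = subsingleton-case (λ { zero zero → refl }) ≤-refl G
theorem5 {suc (suc m)} G conn P = tour-case G bfs (proj₁ tour) (proj₂ tour)
  where
  bfs : LayeredTree G
  bfs = bfsTree G conn zero
  first : ∀ {x y} → Graph.Connects G x y → x ≢ y → Σ[ d ∈ Dart G ] Dart.source d ≡ x
  first ε               x≢x = contradiction refl x≢x
  first (_◅_ {_} {y} e _) _ = dart _ y e , refl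
  -- A path from the root to a second vertex begins with the dart at which the tour starts.
  d₀ : Σ[ d ∈ Dart G ] Dart.source d ≡ zero
  d₀ = first (conn zero (suc zero)) λ ()
  tour : Σ[ t ∈ Tour (LayeredTree.tree bfs) ] (∀ {x y} → Graph._~_ G x y → Tour.Joined t x y)
  tour = SpanningTour.spanningTour P bfs refl (proj₁ d₀) (proj₂ d₀)
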